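{- For every constant $L$ there is a polynomial-time algorithm and a function $\varepsilon:\mathbb{N}\to\mathbb{R}_{\ge 0}$ with $\varepsilon(d)\to 0$ as $d\to\infty$ such that, given any finite connected graph $G$ of diameter $d$ together with a tree decomposition of $G$ of length at most $L$, the algorithm outputs a burning schedule that burns all vertices of $G$ within at most $(2+\varepsilon(d))\, bn(G)$ rounds. (That is, the algorithm achieves an approximation factor of $2+o(1)$ for burning graphs of bounded tree-length.)
   Context: Graphs are finite, simple, undirected and unweighted; $d(u,v)$ denotes the shortest-path distance. Burning process: it takes place in synchronous rounds $1,2,\dots$. In each round $i$, every vertex having a neighbour that was burned in an earlier round becomes burned, and additionally one chosen vertex $a_i$ (the activator of round $i$) becomes burned; burned vertices stay burned. A burning schedule $\langle a_1,\dots,a_m\rangle$ burns $G$ in $m$ rounds if all vertices are burned by the end of round $m$, equivalently every vertex $v$ satisfies $d(v,a_i)\le m-i$ for some $i\in\{1,\dots,m\}$. The burning number $bn(G)$ is the minimum $m$ for which a burning schedule burning $G$ in $m$ rounds exists. A tree decomposition of $G$ is a tree whose nodes are finitely many bags, each bag being a subset of the vertices of $G$, such that every edge $\{v,w\}$ of $G$ has both endpoints in some common bag, and for every vertex $v$ of $G$ the bags containing $v$ form a (nonempty) connected subtree. The length of a decomposition is the maximum of $d(x,y)$ (distance in $G$) over all pairs $x,y$ lying in a common bag; the tree-length of $G$ is the minimum length over all its tree decompositions. -}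

module Defs where

open import Data.Bool.Base using (Bool; false; T; if_then_else_)
open import Data.Empty using (⊥)
open import Data.Fin.Base using (Fin; toℕ)
open import Data.Fin.Subset using (Subset; _∈_)
open import Data.Integer.Base using (+_)
open import Data.List.Base using (List; []; _∷_; _++_; [_]; length; tabulate)
open import Data.List.Relation.Unary.Linked using (Linked)
open import Data.List.Relation.Unary.Unique.Propositional using (Unique)
open import Data.Nat.Base using (ℕ; zero; suc; _+_; _*_; _^_; _≤_)
open import Data.Product.Base using (_×_; _,_; ∃-syntax)
import Data.Rational.Base as ℚ
open ℚ using (ℚ; 0ℚ)
open import Data.Vec.Base using (Vec; lookup; toList; map)
open import Level using (0ℓ)
open import Relation.Binary.Core using (Rel)
open import Relation.Binary.Construct.Closure.ReflexiveTransitive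
  using (Star; fold)
open import Relation.Binary.PropositionalEquality using (_≡_)
open import Relation.Nullary.Negation.Core using (¬_)

IsMinimum IsMaximum : (ℕ → Set) → ℕ → Set
IsMinimum P m = P m × (∀ k → P k → m ≤ k)
IsMaximum P m = P m × (∀ k → P k → k ≤ m)

------------------------------------------------------------------------
-- Graphs

record Graph (n : ℕ) : Set where
  field
    adj        : Fin n → Fin n → Bool
    adj-sym    : ∀ u v → adj u v ≡ adj v u
    adj-irrefl : ∀ v → adj v v ≡ false

open Graph public

module _ {n : ℕ} (G : Graph n) where

  Edge : Rel (Fin n) 0ℓ
  Edge u v = T (adj G u v)

  Walk : Rel (Fin n) 0ℓ
  Walk = Star Edge

  walkLength : ∀ {u v} → Walk u v → ℕ
  walkLength = fold (λ _ _ → ℕ) (λ _ k → suc k) 0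

  -- IsDistance u v k  says  d(u,v) = k.
  IsDistance : Fin n → Fin n → ℕ → Set
  IsDistance u v = IsMinimum (λ k → ∃[ w ] walkLength {u} {v} w ≡ k)

  IsDiameter : ℕ → Set
  IsDiameter = IsMaximum (λ k → ∃[ u ] ∃[ v ] IsDistance u v k)

  -- The component Fin n excludes the graph without vertices.
  Connected : Set
  Connected = Fin n × (∀ u v → Walk u v)

  IsCycle : List (Fin n) → Set
  IsCycle []       = ⊥
  IsCycle (v ∷ vs) =
    Unique (v ∷ vs) × 3 ≤ length (v ∷ vs) × Linked Edge (v ∷ vs ++ [ v ])

  IsTree : Set
  IsTree = Connected × (∀ vs → ¬ IsCycle vs)

------------------------------------------------------------------------
-- Tree decompositions

-- The nodes of the tree are Fin k, and node i carries the bag  bag i.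
record TreeDecomposition {n : ℕ} (G : Graph n) (k : ℕ) : Set where
  field
    tree          : Graph k
    tree-isTree   : IsTree tree
    bag           : Fin k → Subset n
    covers-edge   : ∀ u v → Edge G u v → ∃[ i ] (u ∈ bag i × v ∈ bag i)
    covers-vertex : ∀ v → ∃[ i ] v ∈ bag i
    bags-connected : ∀ v i j → v ∈ bag i → v ∈ bag j →
      Star (λ x y → Edge tree x y × v ∈ bag x × v ∈ bag y) i j

  IsDecompositionLength : ℕ → Set
  IsDecompositionLength = IsMaximum (λ l →
    ∃[ i ] ∃[ x ] ∃[ y ] (x ∈ bag i × y ∈ bag i × IsDistance G x y l))

open TreeDecomposition public

------------------------------------------------------------------------
-- Burning

module _ {n : ℕ} (G : Graph n) where

  -- Burned as r v : v is burned by the end of round r.  Rounds are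
  -- numbered from 1, so the activator of round suc (toℕ i) is
  -- lookup as i, and nothing is burned at the end of round 0.
  data Burned {m : ℕ} (as : Vec (Fin n) m) : ℕ → Fin n → Set where
    activate : ∀ i → Burned as (suc (toℕ i)) (lookup as i)
    spread   : ∀ {r u v} → Edge G u v → Burned as r u → Burned as (suc r) v
    stay     : ∀ {r v} → Burned as r v → Burned as (suc r) v

  Burns : ∀ {m} → Vec (Fin n) m → Set
  Burns {m} as = ∀ v → Burned as m v

  IsBurningNumber : ℕ → Set
  IsBurningNumber = IsMinimum (λ m → ∃[ as ] Burns {m} as)

------------------------------------------------------------------------
-- Programs and their running time
--
-- A first-order functional language with unbounded while loops.  The
-- data are unary numerals, pairs and lists, and the only primitives on
-- them are constructors and one-level case distinctions.  If values are
-- stored as pointers, every evaluation step takes constant time and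
-- allocates boundedly many cells (pairing shares its components), so
-- the costs below agree with Turing machine time up to a polynomial.

infixr 6 _⊗_
infix  4 _⇒_
infixr 5 _⨾_

data Ty : Set where
  nat  : Ty
  list : Ty → Ty
  _⊗_  : Ty → Ty → Ty

⟦_⟧ : Ty → Set
⟦ nat ⟧    = ℕ
⟦ list A ⟧ = List ⟦ A ⟧
⟦ A ⊗ B ⟧  = ⟦ A ⟧ × ⟦ B ⟧

data _⇒_ : Ty → Ty → Set where
  id       : ∀ {A} → A ⇒ A
  _⨾_      : ∀ {A B C} → A ⇒ B → B ⇒ C → A ⇒ C
  ⟨_,_⟩    : ∀ {A B C} → A ⇒ B → A ⇒ C → A ⇒ B ⊗ C
  fst      : ∀ {A B} → A ⊗ B ⇒ A
  snd      : ∀ {A B} → A ⊗ B ⇒ B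
  zeroₚ    : ∀ {A} → A ⇒ nat
  sucₚ     : nat ⇒ nat
  caseNat  : ∀ {A B} → A ⇒ B → nat ⊗ A ⇒ B → nat ⊗ A ⇒ B
  nil      : ∀ {A B} → A ⇒ list B
  cons     : ∀ {A} → A ⊗ list A ⇒ list A
  caseList : ∀ {A B C} → A ⇒ B → (C ⊗ list C) ⊗ A ⇒ B → list C ⊗ A ⇒ B
  -- while c f : apply f as long as c yields a nonzero number.
  while    : ∀ {A} → A ⇒ nat → A ⇒ A → A ⇒ A

infix 4 _∣_⇓_∙_

-- p ∣ x ⇓ y ∙ t : on input x the program p halts with output y after
-- t steps.
data _∣_⇓_∙_ : ∀ {A B} → A ⇒ B → ⟦ A ⟧ → ⟦ B ⟧ → ℕ → Set where
  ⇓id : ∀ {A} {x : ⟦ A ⟧} → id {A} ∣ x ⇓ x ∙ 1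
  ⇓⨾ : ∀ {A B C} {p : A ⇒ B} {q : B ⇒ C} {x y z s t} →
    p ∣ x ⇓ y ∙ s → q ∣ y ⇓ z ∙ t → (p ⨾ q) ∣ x ⇓ z ∙ suc (s + t)
  ⇓⟨,⟩ : ∀ {A B C} {p : A ⇒ B} {q : A ⇒ C} {x y z s t} →
    p ∣ x ⇓ y ∙ s → q ∣ x ⇓ z ∙ t → ⟨ p , q ⟩ ∣ x ⇓ (y , z) ∙ suc (s + t)
  ⇓fst : ∀ {A B} {x : ⟦ A ⟧} {y : ⟦ B ⟧} → fst {A} {B} ∣ (x , y) ⇓ x ∙ 1
  ⇓snd : ∀ {A B} {x : ⟦ A ⟧} {y : ⟦ B ⟧} → snd {A} {B} ∣ (x , y) ⇓ y ∙ 1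
  ⇓zero : ∀ {A} {x : ⟦ A ⟧} → zeroₚ {A} ∣ x ⇓ zero ∙ 1
  ⇓suc : ∀ {k} → sucₚ ∣ k ⇓ suc k ∙ 1
  ⇓caseNat-zero : ∀ {A B} {p : A ⇒ B} {q : nat ⊗ A ⇒ B} {x y t} →
    p ∣ x ⇓ y ∙ t → caseNat p q ∣ (zero , x) ⇓ y ∙ suc t
  ⇓caseNat-suc : ∀ {A B} {p : A ⇒ B} {q : nat ⊗ A ⇒ B} {k x y t} →
    q ∣ (k , x) ⇓ y ∙ t → caseNat p q ∣ (suc k , x) ⇓ y ∙ suc t
  ⇓nil : ∀ {A B} {x : ⟦ A ⟧} → nil {A} {B} ∣ x ⇓ [] ∙ 1
  ⇓cons : ∀ {A} {x : ⟦ A ⟧} {xs : List ⟦ A ⟧} →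
    cons {A} ∣ (x , xs) ⇓ (x ∷ xs) ∙ 1
  ⇓caseList-nil : ∀ {A B C} {p : A ⇒ B} {q : (C ⊗ list C) ⊗ A ⇒ B}
    {x y t} →
    p ∣ x ⇓ y ∙ t → caseList p q ∣ ([] , x) ⇓ y ∙ suc t
  ⇓caseList-cons : ∀ {A B C} {p : A ⇒ B} {q : (C ⊗ list C) ⊗ A ⇒ B}
    {c cs x y t} →
    q ∣ ((c , cs) , x) ⇓ y ∙ t → caseList p q ∣ ((c ∷ cs) , x) ⇓ y ∙ suc t
  ⇓while-stop : ∀ {A} {c : A ⇒ nat} {f : A ⇒ A} {x t} →
    c ∣ x ⇓ zero ∙ t → while c f ∣ x ⇓ x ∙ suc t
  ⇓while-step : ∀ {A} {c : A ⇒ nat} {f : A ⇒ A} {k x y z r s t} →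
    c ∣ x ⇓ suc k ∙ r → f ∣ x ⇓ y ∙ s → while c f ∣ y ⇓ z ∙ t →
    while c f ∣ x ⇓ z ∙ suc (r + s + t)

size : ∀ A → ⟦ A ⟧ → ℕ
size nat      k        = suc k
size (list A) []       = 1
size (list A) (x ∷ xs) = suc (size A x + size (list A) xs)
size (A ⊗ B)  (x , y)  = suc (size A x + size B y)

-- Every polynomial in s is bounded by one of this form.
polyBound : ℕ → ℕ → ℕ → ℕ
polyBound c e s = c * s ^ e + c

------------------------------------------------------------------------
-- Encoding of inputs and outputs

Matrix Input Schedule : Ty
Matrix   = list (list nat)
Input    = Matrix ⊗ Matrix ⊗ Matrix
Schedule = list nat

matrix : ∀ {m n} → (Fin m → Fin n → Bool) → ⟦ Matrix ⟧
matrix M = tabulate λ i → tabulate λ j → if M i j then 1 else 0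

-- The adjacency matrix of the graph, the adjacency matrix of the tree,
-- and the incidence matrix whose i-th row is the i-th bag.
encode : ∀ {n k} (G : Graph n) → TreeDecomposition G k → ⟦ Input ⟧
encode G D =
  matrix (adj G) , matrix (adj (tree D)) , matrix (λ i → lookup (bag D i))

encodeSchedule : ∀ {n m} → Vec (Fin n) m → ⟦ Schedule ⟧
encodeSchedule as = toList (map toℕ as)

------------------------------------------------------------------------
-- Error terms

fromℕ : ℕ → ℚ
fromℕ m = + m ℚ./ 1

TendsToZero : (ℕ → ℚ) → Set
TendsToZero f =
  ∀ δ → 0ℚ ℚ.< δ → ∃[ N ] (∀ d → N ≤ d → ℚ.∣ f d ∣ ℚ.< δ)

{-# OPTIONS --safe #-}

-- If b rounds burn the graph, then at most b vertices have pairwise distance more than 2 (b − 1).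
-- Scanning the vertices by decreasing distance from a root, pick greedily vertices at pairwise
-- distance more than 2 r.  Every vertex v is then within 2 r of a pick p that is at least as far from
-- the root as v, and graphs of tree-length L are hyperbolic enough for a vertex c that lies r steps
-- before p on the way from the root to be within r + 2 L of v.  For the least r with at most r + 1
-- picks, activating the vertices c in any order burns everything within 2 b + 2 L rounds.
-- The packing bound on a geodesic gives d < 2 b², so 2 L is a vanishing fraction of b as d grows.
module Submission where

open import Defs
open import Data.Bool.Base using (Bool; true; false; if_then_else_; not; _∧_; T)
open import Data.Bool.Properties using (T?)
open import Data.Fin.Base as Fin using (Fin; toℕ; zero; suc)
import Data.Fin.Properties as Fin
open import Data.Fin.Subset using () renaming (_∈_ to _∈ˢ_)
open import Data.Fin.Subset.Properties using () renaming (_∈?_ to _∈ˢ?_)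
import Data.Integer.Base as ℤ
import Data.Integer.Properties as ℤ
open import Data.List.Base
  using (List; []; _∷_; _++_; [_]; length; map; filter; foldl; foldr; reverse; replicate; upTo;
         downFrom; lookup; tabulate; allFin; applyUpTo)
open import Data.List.Membership.Propositional using (_∈_; find; lose)
open import Data.List.Membership.Propositional.Properties
  using (∈-++⁺ˡ; ∈-++⁺ʳ; ∈-++⁻; ∈-filter⁺; ∈-filter⁻; ∈-upTo⁺; ∈-map⁺; ∈-lookup; ∈-allFin)
open import Data.List.Properties
  using (reverse-foldl; reverse-downFrom; length-downFrom; ++-is-foldr; map-is-foldr; map-++;
         length-map; length-++; length-replicate; length-tabulate; map-replicate; map-tabulate;
         map-∘; map-cong; filter-≐)
open import Data.List.Relation.Unary.All as All using (All; []; _∷_)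
open import Data.List.Relation.Unary.AllPairs using (AllPairs; []; _∷_)
import Data.List.Relation.Unary.AllPairs.Properties as AllPairs
open import Data.List.Relation.Unary.Any as Any using (Any; any?; here; there)
import Data.List.Relation.Unary.Any.Properties as Any
open import Data.List.Relation.Unary.Linked using (Linked; [-]; _∷_)
open import Data.List.Relation.Unary.Unique.Propositional using (Unique)
open import Data.Nat.Base hiding (_/_)
open import Data.Nat.Logarithm using (⌊log₂_⌋; ⌊log₂⌋-mono-≤; ⌊log₂[2^n]⌋≡n)
open import Data.Nat.Properties
open import Data.Nat.Tactic.RingSolver using (solve-∀)
open import Data.Product.Base as Product using (Σ-syntax; ∃-syntax; _×_; _,_; proj₁; proj₂)
open import Data.Rational.Base as ℚ using (ℚ; 0ℚ; mkℚ; toℚᵘ; fromℚᵘ)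
import Data.Rational.Properties as ℚ
open import Data.Rational.Unnormalised.Base as ℚᵘ using (ℚᵘ; mkℚᵘ)
import Data.Rational.Unnormalised.Properties as ℚᵘ
open import Data.Sum.Base using (_⊎_; inj₁; inj₂)
open import Data.Vec.Base as Vec using (Vec; fromList)
open import Data.Vec.Properties using (lookup∘tabulate; toList-map; toList∘fromList)
open import Function.Base using (_∘_)
open import Function.Bundles using (_⇔_; mk⇔; Equivalence)
open import Function.Definitions using (Injective)
open import Relation.Binary.Construct.Closure.ReflexiveTransitive as Star
  using (Star; ε; _◅_; _◅◅_)
open import Relation.Binary.Definitions
  using (DecidableEquality; Reflexive; Symmetric; tri<; tri≈; tri>)
open import Relation.Binary.PropositionalEquality hiding ([_])
open import Relation.Nullary.Decidable
  using (Dec; yes; no; does; ¬?; _×-dec_; map′; does-⇔; dec-true)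
open import Relation.Nullary.Negation using (¬_; contradiction)

-- Polynomial-time programs

-- Activating the picks themselves would give the factor 3: `r + 1` activations and then `2 r`
-- rounds of spreading. Moving each centre `r` steps towards the root halves the spreading radius.
-- In a tree this is exact. Let the path from `p` to `v` leave the path from `p` to the root at `q`.
-- If `c` lies between `p` and `q`, then `d c v = d p v - r`, which is at most `r`. If `q` lies
-- between `p` and `c`, then `v` is no farther from `q` than `p` is, because it is no farther from
-- the root, so `d c v` is at most `d c p`. In general a bag takes the place of `q`, and either case
-- pays `L` twice.
--
-- The burning number is unknown to the program, but `b - 1` passes the test on the number of picks.
-- The least passing radius is therefore at most `b - 1`, and the test itself limits the number of
-- activations.
--
-- Costs are defined only for programs over numerals, pairs and lists, whereas the graph arguments
-- live on `Fin n`. The algorithm is thus written once over an abstract vertex type, compiled for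
-- numerals, verified on `Fin n`, and the two runs are matched.

infixl 6 _⊕_
infixl 7 _⊛_
infixr 8 _⊙_

-- Closed under composition, so that the bounds of composed programs and loops can be written down
-- directly; the normal form `polyBound` is computed once, at the end. With natural coefficients
-- every polynomial is monotone.
data Polynomial : Set where
  con         : ℕ → Polynomial
  var         : Polynomial
  _⊕_ _⊛_ _⊙_ : Polynomial → Polynomial → Polynomial

eval : Polynomial → ℕ → ℕ
eval (con k) s = k
eval var     s = s
eval (p ⊕ q) s = eval p s + eval q s
eval (p ⊛ q) s = eval p s * eval q s
eval (p ⊙ q) s = eval p (eval q s)

eval-mono : ∀ p {s t} → s ≤ t → eval p s ≤ eval p t
eval-mono (con k) s≤t = ≤-refl
eval-mono var     s≤t = s≤t
eval-mono (p ⊕ q) s≤t = +-mono-≤ (eval-mono p s≤t) (eval-mono q s≤t)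
eval-mono (p ⊛ q) s≤t = *-mono-≤ (eval-mono p s≤t) (eval-mono q s≤t)
eval-mono (p ⊙ q) s≤t = eval-mono p (eval-mono q s≤t)

1≤suc^ : ∀ s e → 1 ≤ suc s ^ e
1≤suc^ s e = ^-monoʳ-≤ (suc s) (z≤n {e})

^-distribʳ-* : ∀ e m n → (m * n) ^ e ≡ m ^ e * n ^ e
^-distribʳ-* zero    m n = refl
^-distribʳ-* (suc e) m n =
  trans (cong (m * n *_) (^-distribʳ-* e m n)) ([m*n]*[o*p]≡[m*o]*[n*p] m n _ _)

-- For positive `s` this is `suc s ≤ 2 * s`; the summand 1 pays for `s = 0`, where `s ^ e` may
-- vanish.
suc^≤ : ∀ s e → suc s ^ e ≤ 2 ^ e * s ^ e + 1
suc^≤ zero    e = ≤-trans (≤-reflexive (^-zeroˡ e)) (m≤n+m 1 _)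
suc^≤ (suc s) e = begin
  suc (suc s) ^ e           ≤⟨ ^-monoˡ-≤ e (s≤s (≤-trans (m≤n+m (suc s) s) (+-monoʳ-≤ s (m≤m+n (suc s) 0)))) ⟩
  (2 * suc s) ^ e           ≡⟨ ^-distribʳ-* e 2 (suc s) ⟩
  2 ^ e * suc s ^ e         ≤⟨ m≤m+n _ 1 ⟩
  2 ^ e * suc s ^ e + 1     ∎
  where open ≤-Reasoning

-- The base `suc s` is positive, so exponents can be raised to a common one and constants absorbed
-- without a case distinction.
eval≤monomial : ∀ p → ∃[ c ] ∃[ e ] (∀ s → eval p s ≤ c * suc s ^ e)
eval≤monomial (con k) = k , 0 , λ s → ≤-reflexive (sym (*-identityʳ k))
eval≤monomial var     = 1 , 1 , λ s →
  ≤-trans (n≤1+n s) (≤-reflexive (sym (trans (*-identityˡ _) (*-identityʳ (suc s)))))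
eval≤monomial (p ⊕ q) with eval≤monomial p | eval≤monomial q
... | c , d , p≤ | c′ , d′ , q≤ = c + c′ , d + d′ , λ s → begin
  eval p s + eval q s
    ≤⟨ +-mono-≤ (≤-trans (p≤ s) (*-monoʳ-≤ c (^-monoʳ-≤ (suc s) (m≤m+n d d′))))
                (≤-trans (q≤ s) (*-monoʳ-≤ c′ (^-monoʳ-≤ (suc s) (m≤n+m d′ d)))) ⟩
  c * suc s ^ (d + d′) + c′ * suc s ^ (d + d′)
    ≡⟨ *-distribʳ-+ (suc s ^ (d + d′)) c c′ ⟨
  (c + c′) * suc s ^ (d + d′) ∎
  where open ≤-Reasoning
eval≤monomial (p ⊛ q) with eval≤monomial p | eval≤monomial q
... | c , d , p≤ | c′ , d′ , q≤ = c * c′ , d + d′ , λ s → begin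
  eval p s * eval q s                   ≤⟨ *-mono-≤ (p≤ s) (q≤ s) ⟩
  c * suc s ^ d * (c′ * suc s ^ d′)     ≡⟨ [m*n]*[o*p]≡[m*o]*[n*p] c _ c′ _ ⟩
  c * c′ * (suc s ^ d * suc s ^ d′)     ≡⟨ cong (c * c′ *_) (^-distribˡ-+-* (suc s) d d′) ⟨
  c * c′ * suc s ^ (d + d′)             ∎
  where open ≤-Reasoning
eval≤monomial (p ⊙ q) with eval≤monomial p | eval≤monomial q
... | c , d , p≤ | c′ , d′ , q≤ = c * suc c′ ^ d , d′ * d , λ s → begin
  eval p (eval q s)
    ≤⟨ p≤ (eval q s) ⟩
  c * suc (eval q s) ^ d
    ≤⟨ *-monoʳ-≤ c (^-monoˡ-≤ d (+-mono-≤ (1≤suc^ s d′) (q≤ s))) ⟩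
  c * (suc c′ * suc s ^ d′) ^ d
    ≡⟨ cong (c *_) (^-distribʳ-* d (suc c′) (suc s ^ d′)) ⟩
  c * (suc c′ ^ d * (suc s ^ d′) ^ d)
    ≡⟨ *-assoc c _ _ ⟨
  c * suc c′ ^ d * (suc s ^ d′) ^ d
    ≡⟨ cong (c * suc c′ ^ d *_) (^-*-assoc (suc s) d′ d) ⟩
  c * suc c′ ^ d * suc s ^ (d′ * d) ∎
  where open ≤-Reasoning

eval≤polyBound : ∀ p → ∃[ c ] ∃[ e ] (∀ s → eval p s ≤ polyBound c e s)
eval≤polyBound p with eval≤monomial p
... | c , e , p≤ = c * 2 ^ e + c , e , λ s → begin
  eval p s                                          ≤⟨ p≤ s ⟩
  c * suc s ^ e                                     ≤⟨ *-monoʳ-≤ c (suc^≤ s e) ⟩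
  c * (2 ^ e * s ^ e + 1)                           ≡⟨ *-distribˡ-+ c _ 1 ⟩
  c * (2 ^ e * s ^ e) + c * 1                       ≡⟨ cong₂ _+_ (sym (*-assoc c _ _)) (*-identityʳ c) ⟩
  c * 2 ^ e * s ^ e + c                             ≤⟨ +-mono-≤ (*-monoˡ-≤ (s ^ e) (m≤m+n (c * 2 ^ e) c)) (m≤n+m c _) ⟩
  (c * 2 ^ e + c) * s ^ e + (c * 2 ^ e + c)         ∎
  where open ≤-Reasoning

-- The output size needs a bound of its own: pairing shares its components, so each step may double
-- the size and the running time does not control it. In a composition, `growth` bounds the input of
-- the second program.
record PolyTime (A B : Ty) (f : ⟦ A ⟧ → ⟦ B ⟧) : Set where
  field
    program : A ⇒ B
    cost    : Polynomial
    growth  : Polynomial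
    halts   : ∀ x → ∃[ t ] (program ∣ x ⇓ f x ∙ t × t ≤ eval cost (size A x))
    size≤   : ∀ x → size B (f x) ≤ eval growth (size A x)

open PolyTime

private
  variable
    A B C Γ X S : Ty

natCase : ∀ {ℓ ℓ′} {A : Set ℓ} {B : Set ℓ′} → (A → B) → (ℕ × A → B) → ℕ × A → B
natCase f g (zero  , x) = f x
natCase f g (suc k , x) = g (k , x)

listCase : ∀ {A B C : Set} → (A → B) → ((C × List C) × A → B) → List C × A → B
listCase f g ([]     , x) = f x
listCase f g (c ∷ cs , x) = g ((c , cs) , x)

idᶜ : PolyTime A A (λ x → x)
idᶜ .program = id
idᶜ .cost    = con 1
idᶜ .growth  = var
idᶜ .halts x = 1 , ⇓id , ≤-refl
idᶜ .size≤ x = ≤-refl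

infixr 5 _▸_
_▸_ : ∀ {f : ⟦ A ⟧ → ⟦ B ⟧} {g : ⟦ B ⟧ → ⟦ C ⟧} →
  PolyTime A B f → PolyTime B C g → PolyTime A C (λ x → g (f x))
(F ▸ G) .program = program F ⨾ program G
(F ▸ G) .cost    = con 1 ⊕ (cost F ⊕ cost G ⊙ growth F)
(F ▸ G) .growth  = growth G ⊙ growth F
_▸_ {f = f} F G .halts x with halts F x | halts G (f x)
... | s , F⇓ , s≤ | t , G⇓ , t≤ =
  suc (s + t) , ⇓⨾ F⇓ G⇓ , s≤s (+-mono-≤ s≤ (≤-trans t≤ (eval-mono (cost G) (size≤ F x))))
_▸_ {f = f} F G .size≤ x = ≤-trans (size≤ G (f x)) (eval-mono (growth G) (size≤ F x))

⟪_,_⟫ : ∀ {f : ⟦ A ⟧ → ⟦ B ⟧} {g : ⟦ A ⟧ → ⟦ C ⟧} →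
  PolyTime A B f → PolyTime A C g → PolyTime A (B ⊗ C) (λ x → f x , g x)
⟪ F , G ⟫ .program = ⟨ program F , program G ⟩
⟪ F , G ⟫ .cost    = con 1 ⊕ (cost F ⊕ cost G)
⟪ F , G ⟫ .growth  = con 1 ⊕ (growth F ⊕ growth G)
⟪ F , G ⟫ .halts x with halts F x | halts G x
... | s , F⇓ , s≤ | t , G⇓ , t≤ = suc (s + t) , ⇓⟨,⟩ F⇓ G⇓ , s≤s (+-mono-≤ s≤ t≤)
⟪ F , G ⟫ .size≤ x = s≤s (+-mono-≤ (size≤ F x) (size≤ G x))

fstᶜ : PolyTime (A ⊗ B) A proj₁
fstᶜ .program = fst
fstᶜ .cost    = con 1
fstᶜ .growth  = var
fstᶜ .halts x = 1 , ⇓fst , ≤-refl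
fstᶜ .size≤ x = m≤n⇒m≤1+n (m≤m+n _ _)

sndᶜ : PolyTime (A ⊗ B) B proj₂
sndᶜ .program = snd
sndᶜ .cost    = con 1
sndᶜ .growth  = var
sndᶜ .halts x = 1 , ⇓snd , ≤-refl
sndᶜ {A} .size≤ x = m≤n⇒m≤1+n (m≤n+m _ (size A (proj₁ x)))

numeral : ∀ k → PolyTime A nat (λ _ → k)
numeral zero .program = zeroₚ
numeral zero .cost    = con 1
numeral zero .growth  = con 1
numeral zero .halts x = 1 , ⇓zero , ≤-refl
numeral zero .size≤ x = ≤-refl
numeral (suc k) .program = program (numeral k) ⨾ sucₚ
numeral (suc k) .cost    = con 1 ⊕ (cost (numeral k) ⊕ con 1)
numeral (suc k) .growth  = con 1 ⊕ growth (numeral k)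
numeral (suc k) .halts x with halts (numeral k) x
... | t , k⇓ , t≤ = suc (t + 1) , ⇓⨾ k⇓ ⇓suc , s≤s (+-monoˡ-≤ 1 t≤)
numeral (suc k) .size≤ x = s≤s (size≤ (numeral k) x)

sucᶜ : PolyTime nat nat suc
sucᶜ .program = sucₚ
sucᶜ .cost    = con 1
sucᶜ .growth  = con 1 ⊕ var
sucᶜ .halts x = 1 , ⇓suc , ≤-refl
sucᶜ .size≤ x = ≤-refl

nilᶜ : PolyTime A (list B) (λ _ → [])
nilᶜ .program = nil
nilᶜ .cost    = con 1
nilᶜ .growth  = con 1
nilᶜ .halts x = 1 , ⇓nil , ≤-refl
nilᶜ .size≤ x = ≤-refl

consᶜ : PolyTime (A ⊗ list A) (list A) (λ (x , xs) → x ∷ xs)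
consᶜ .program = cons
consᶜ .cost    = con 1
consᶜ .growth  = var
consᶜ .halts x = 1 , ⇓cons , ≤-refl
consᶜ .size≤ x = ≤-refl

caseNatᶜ : ∀ {f : ⟦ A ⟧ → ⟦ B ⟧} {g} → PolyTime A B f → PolyTime (nat ⊗ A) B g →
  PolyTime (nat ⊗ A) B (natCase f g)
caseNatᶜ F G .program = caseNat (program F) (program G)
caseNatᶜ F G .cost    = con 1 ⊕ (cost F ⊕ cost G)
caseNatᶜ F G .growth  = growth F ⊕ growth G
caseNatᶜ F G .halts (zero , x) with halts F x
... | t , F⇓ , t≤ = suc t , ⇓caseNat-zero F⇓ , s≤s (m≤n⇒m≤n+o _
  (≤-trans t≤ (eval-mono (cost F) (m≤n⇒m≤1+n (m≤n+m _ 1)))))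
caseNatᶜ F G .halts (suc k , x) with halts G (k , x)
... | t , G⇓ , t≤ = suc t , ⇓caseNat-suc G⇓ , s≤s (m≤n⇒m≤o+n (eval (cost F) _)
  (≤-trans t≤ (eval-mono (cost G) (n≤1+n _))))
caseNatᶜ F G .size≤ (zero , x) = m≤n⇒m≤n+o _
  (≤-trans (size≤ F x) (eval-mono (growth F) (m≤n⇒m≤1+n (m≤n+m _ 1))))
caseNatᶜ F G .size≤ (suc k , x) = m≤n⇒m≤o+n (eval (growth F) _)
  (≤-trans (size≤ G (k , x)) (eval-mono (growth G) (n≤1+n _)))

caseListᶜ : ∀ {f : ⟦ A ⟧ → ⟦ B ⟧} {g} →
  PolyTime A B f → PolyTime ((C ⊗ list C) ⊗ A) B g →
  PolyTime (list C ⊗ A) B (listCase f g)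
caseListᶜ F G .program = caseList (program F) (program G)
caseListᶜ F G .cost    = con 1 ⊕ (cost F ⊕ cost G)
caseListᶜ F G .growth  = growth F ⊕ growth G
caseListᶜ F G .halts ([] , x) with halts F x
... | t , F⇓ , t≤ = suc t , ⇓caseList-nil F⇓ , s≤s (m≤n⇒m≤n+o _
  (≤-trans t≤ (eval-mono (cost F) (m≤n⇒m≤1+n (m≤n+m _ 1)))))
caseListᶜ F G .halts (c ∷ cs , x) with halts G ((c , cs) , x)
... | t , G⇓ , t≤ = suc t , ⇓caseList-cons G⇓ , s≤s (m≤n⇒m≤o+n (eval (cost F) _) t≤)
caseListᶜ F G .size≤ ([] , x) = m≤n⇒m≤n+o _
  (≤-trans (size≤ F x) (eval-mono (growth F) (m≤n⇒m≤1+n (m≤n+m _ 1))))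
caseListᶜ F G .size≤ (c ∷ cs , x) =
  m≤n⇒m≤o+n (eval (growth F) _) (size≤ G ((c , cs) , x))

extensional : ∀ {f g : ⟦ A ⟧ → ⟦ B ⟧} → (∀ x → f x ≡ g x) →
  PolyTime A B f → PolyTime A B g
extensional f≗g F .program = program F
extensional f≗g F .cost    = cost F
extensional f≗g F .growth  = growth F
extensional f≗g F .halts x = subst
  (λ y → ∃[ t ] (program F ∣ x ⇓ y ∙ t × t ≤ _)) (f≗g x) (halts F x)
extensional f≗g F .size≤ x = subst (λ y → size _ y ≤ _) (f≗g x) (size≤ F x)

data Loop {A : Set} (c : A → ℕ) (f : A → A) : ℕ → A → A → Set where
  stop : ∀ {x} → c x ≡ 0 → Loop c f 0 x x
  step : ∀ {j k x y} → c x ≡ suc k → Loop c f j (f x) y → Loop c f (suc j) x y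

module _ {c : ⟦ A ⟧ → ℕ} {f result : ⟦ A ⟧ → ⟦ A ⟧}
  (C : PolyTime A nat c) (F : PolyTime A A f)
  (Φ : ⟦ A ⟧ → ℕ) (Q : Polynomial)
  (size≤Φ : ∀ x → size A x ≤ Φ x)
  (Φ-decreasing : ∀ x {k} → c x ≡ suc k → Φ (f x) ≤ Φ x)
  (Φ≤Q : ∀ x → Φ x ≤ eval Q (size A x))
  (loops : ∀ x → ∃[ j ] (Loop c f j x (result x) × j ≤ size A x))
  where

  -- Φ bounds the sizes of all later states.
  private
    round : Polynomial
    round = con 1 ⊕ (cost C ⊕ cost F)

    while-halts : ∀ {j x y} → Loop c f j x y →
      ∃[ t ] (while (program C) (program F) ∣ x ⇓ y ∙ t × t ≤ suc j * eval round (Φ x))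
    while-halts {x = x} (stop c≡0) with halts C x
    ... | t , C⇓ , t≤ = suc t , ⇓while-stop (subst (λ v → program C ∣ x ⇓ v ∙ t) c≡0 C⇓) ,
      m≤n⇒m≤n+o 0 (s≤s (m≤n⇒m≤n+o _ (≤-trans t≤ (eval-mono (cost C) (size≤Φ x)))))
    while-halts {suc j} {x} (step c≡suc loop) with halts C x | halts F x | while-halts loop
    ... | r , C⇓ , r≤ | s , F⇓ , s≤ | t , rest⇓ , t≤ =
      suc (r + s + t) ,
      ⇓while-step (subst (λ v → program C ∣ x ⇓ v ∙ r) c≡suc C⇓) F⇓ rest⇓ ,
      s≤s (+-mono-≤
        (+-mono-≤ (≤-trans r≤ (eval-mono (cost C) (size≤Φ x)))
                  (≤-trans s≤ (eval-mono (cost F) (size≤Φ x))))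
        (≤-trans t≤ (*-monoʳ-≤ (suc j) (eval-mono round (Φ-decreasing x c≡suc)))))

    Φ-loop : ∀ {j x y} → Loop c f j x y → Φ y ≤ Φ x
    Φ-loop (stop _)          = ≤-refl
    Φ-loop (step c≡suc loop) = ≤-trans (Φ-loop loop) (Φ-decreasing _ c≡suc)

  -- There are at most `size A x` iterations. Each costs at most `round` at the initial potential,
  -- because the potential bounds every state and never increases.
  whileᶜ : PolyTime A A result
  whileᶜ .program = while (program C) (program F)
  whileᶜ .cost    = (con 1 ⊕ var) ⊛ round ⊙ Q
  whileᶜ .growth  = Q
  whileᶜ .halts x with loops x
  ... | j , loop , j≤ with while-halts loop
  ... | t , ⇓y , t≤ = t , ⇓y , ≤-trans t≤ (*-mono-≤ (s≤s j≤) (eval-mono round (Φ≤Q x)))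
  whileᶜ .size≤ x with loops x
  ... | j , loop , _ = ≤-trans (size≤Φ _) (≤-trans (Φ-loop loop) (Φ≤Q x))

length≤size : ∀ (xs : List ⟦ A ⟧) → length xs ≤ size (list A) xs
length≤size []           = z≤n
length≤size {A} (x ∷ xs) = s≤s (m≤n⇒m≤o+n (size A x) (length≤size xs))

-- A polynomial bound on the output of each step would compound over the loop, so the growth of the
-- state is required to be additive.
module _ {f : ⟦ X ⊗ S ⊗ Γ ⟧ → ⟦ S ⟧} (F : PolyTime (X ⊗ S ⊗ Γ) S f) (G : Polynomial)
  (f-grows : ∀ x s γ → size S (f (x , s , γ)) ≤ size S s + eval G (size X x + size Γ γ))
  where

  private
    State : Ty
    State = list X ⊗ S ⊗ Γ

    more : ⟦ State ⟧ → ℕ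
    more = listCase (λ _ → 0) (λ _ → 1)

    next : ⟦ State ⟧ → ⟦ State ⟧
    next = listCase (λ y → [] , y) (λ ((x , xs) , s , γ) → xs , f (x , s , γ) , γ)

    -- The product reserves the growth that the remaining elements can still cause. Each of them is
    -- charged at the size of the whole remaining list, so the reserve covers the next step and can
    -- only shrink.
    Φ : ⟦ State ⟧ → ℕ
    Φ (xs , s , γ) = size State (xs , s , γ) + length xs * eval G (size (list X) xs + size Γ γ)

    rearrange : ∀ x a s c g l → suc (a + suc ((s + g) + c)) + l ≤ suc (suc (x + a) + suc (s + c)) + (g + l)
    rearrange x a s c g l = subst (suc (a + suc ((s + g) + c)) + l ≤_) (lemma x a s c g l) (m≤m+n _ (1 + x))
      where
      lemma : ∀ x a s c g l → suc (a + suc ((s + g) + c)) + l + (1 + x) ≡ suc (suc (x + a) + suc (s + c)) + (g + l)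
      lemma = solve-∀

    Φ-decreasing : ∀ y {k} → more y ≡ suc k → Φ (next y) ≤ Φ y
    Φ-decreasing (x ∷ xs , s , γ) _ = ≤-trans
      (+-mono-≤
        (s≤s (+-monoʳ-≤ (size (list X) xs) (s≤s (+-monoˡ-≤ (size Γ γ)
          (≤-trans (f-grows x s γ) (+-monoʳ-≤ (size S s) (eval-mono G
            (+-monoˡ-≤ (size Γ γ) (m≤n⇒m≤1+n (m≤m+n (size X x) _))))))))))
        (*-monoʳ-≤ (length xs) (eval-mono G (+-monoˡ-≤ (size Γ γ)
          (m≤n⇒m≤1+n (m≤n+m (size (list X) xs) (size X x)))))))
      (rearrange (size X x) (size (list X) xs) (size S s) (size Γ γ) _ _)

    Φ≤ : ∀ y → Φ y ≤ eval (var ⊕ var ⊛ G) (size State y)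
    Φ≤ (xs , s , γ) = +-monoʳ-≤ _ (*-mono-≤
      (≤-trans (length≤size {X} xs) (m≤n⇒m≤1+n (m≤m+n _ _)))
      (eval-mono G (m≤n⇒m≤1+n (+-monoʳ-≤ (size (list X) xs) (m≤n⇒m≤1+n (m≤n+m (size Γ γ) (size S s)))))))

    loop : ∀ xs s γ → Loop more next (length xs) (xs , s , γ)
      ([] , foldl (λ s x → f (x , s , γ)) s xs , γ)
    loop []       s γ = stop refl
    loop (x ∷ xs) s γ = step refl (loop xs _ γ)

  foldlᶜ : PolyTime (list X ⊗ S ⊗ Γ) S (λ (xs , s , γ) → foldl (λ s x → f (x , s , γ)) s xs)
  foldlᶜ = whileᶜ {result = λ (xs , s , γ) → [] , foldl (λ s x → f (x , s , γ)) s xs , γ}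
    (caseListᶜ (numeral 0) (numeral 1))
    (caseListᶜ ⟪ nilᶜ , idᶜ ⟫
      ⟪ fstᶜ ▸ sndᶜ , ⟪ ⟪ fstᶜ ▸ fstᶜ , sndᶜ ⟫ ▸ F , sndᶜ ▸ sndᶜ ⟫ ⟫)
    Φ (var ⊕ var ⊛ G) (λ _ → m≤m+n _ _) Φ-decreasing Φ≤
    (λ (xs , s , γ) → length xs , loop xs s γ , ≤-trans (length≤size {X} xs) (m≤n⇒m≤1+n (m≤m+n _ _)))
    ▸ (sndᶜ ▸ fstᶜ)

-- Programs on numerals and lists

reverseᶜ : PolyTime (list A) (list A) reverse
reverseᶜ {A} = ⟪ idᶜ , ⟪ nilᶜ , numeral 0 ⟫ ⟫ ▸
  foldlᶜ {Γ = nat} {f = λ (x , xs , _) → x ∷ xs} (⟪ fstᶜ , sndᶜ ▸ fstᶜ ⟫ ▸ consᶜ) (con 1 ⊕ var)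
    (λ x xs k → subst (_≤ size (list A) xs + suc (size A x + suc k))
       (+-comm _ (suc (size A x))) (+-monoʳ-≤ (size (list A) xs) (s≤s (m≤m+n _ _))))

module _ {f : ⟦ X ⊗ S ⊗ Γ ⟧ → ⟦ S ⟧} (F : PolyTime (X ⊗ S ⊗ Γ) S f) (G : Polynomial)
  (f-grows : ∀ x s γ → size S (f (x , s , γ)) ≤ size S s + eval G (size X x + size Γ γ))
  where

  foldrᶜ : PolyTime (list X ⊗ S ⊗ Γ) S (λ (xs , s , γ) → foldr (λ x s → f (x , s , γ)) s xs)
  foldrᶜ = extensional (λ (xs , s , γ) → reverse-foldl (λ s x → f (x , s , γ)) s xs)
    (⟪ fstᶜ ▸ reverseᶜ , sndᶜ ⟫ ▸ foldlᶜ F G f-grows)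

replicateᶜ : PolyTime (nat ⊗ A) (list A) (λ (k , x) → replicate k x)
replicateᶜ {A} = extensional (λ (k , x) → prepend≡replicate k x) (
  ⟪ fstᶜ , ⟪ nilᶜ , sndᶜ ⟫ ⟫ ▸
  whileᶜ {A = nat ⊗ list A ⊗ A}
    {c = natCase (λ _ → 0) (λ _ → 1)}
    {f = natCase (λ y → 0 , y) (λ (k , xs , x) → k , x ∷ xs , x)}
    {result = λ (k , xs , x) → 0 , prepend k x xs , x}
    (caseNatᶜ (numeral 0) (numeral 1))
    (caseNatᶜ ⟪ numeral 0 , idᶜ ⟫
      ⟪ fstᶜ , ⟪ ⟪ sndᶜ ▸ sndᶜ , sndᶜ ▸ fstᶜ ⟫ ▸ consᶜ , sndᶜ ▸ sndᶜ ⟫ ⟫)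
    (λ (k , xs , x) → size (nat ⊗ list A ⊗ A) (k , xs , x) + k * suc (size A x))
    (var ⊕ var ⊛ (con 1 ⊕ var))
    (λ _ → m≤m+n _ _)
    (λ { (suc k , xs , x) _ → rearrange k (size (list A) xs) (size A x) _ })
    (λ (k , xs , x) → +-monoʳ-≤ _ (*-mono-≤
      (m≤n⇒m≤1+n (≤-trans (n≤1+n k) (m≤m+n (suc k) _)))
      (s≤s (m≤n⇒m≤1+n (m≤n⇒m≤o+n (suc k) (m≤n⇒m≤1+n (m≤n+m _ (size (list A) xs))))))))
    (λ (k , xs , x) → k , loop k xs x , m≤n⇒m≤1+n (≤-trans (n≤1+n k) (m≤m+n (suc k) _)))
  ▸ sndᶜ ▸ fstᶜ)
  where
  prepend : ℕ → ⟦ A ⟧ → List ⟦ A ⟧ → List ⟦ A ⟧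
  prepend zero    x xs = xs
  prepend (suc k) x xs = prepend k x (x ∷ xs)

  prepend-replicate : ∀ k x xs → prepend k x (x ∷ xs) ≡ x ∷ prepend k x xs
  prepend-replicate zero    x xs = refl
  prepend-replicate (suc k) x xs = prepend-replicate k x (x ∷ xs)

  prepend≡replicate : ∀ k x → prepend k x [] ≡ replicate k x
  prepend≡replicate zero    x = refl
  prepend≡replicate (suc k) x = trans (prepend-replicate k x []) (cong (x ∷_) (prepend≡replicate k x))

  loop : ∀ k xs x → Loop (natCase (λ _ → 0) (λ _ → 1)) (natCase (λ y → 0 , y) (λ (k , xs , x) → k , x ∷ xs , x))
    k (k , xs , x) (0 , prepend k x xs , x)
  loop zero    xs x = stop refl
  loop (suc k) xs x = step refl (loop k (x ∷ xs) x)

  rearrange : ∀ k a x l →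
    suc (suc k + suc (suc (x + a) + x)) + l ≤ suc (suc (suc k) + suc (a + x)) + (suc x + l)
  rearrange k a x l = ≤-trans (n≤1+n _) (≤-reflexive (lemma k a x l))
    where
    lemma : ∀ k a x l →
      suc (suc (suc k + suc (suc (x + a) + x)) + l) ≡ suc (suc (suc k) + suc (a + x)) + (suc x + l)
    lemma = solve-∀

-- Decision procedures as programs

bit : Bool → ℕ
bit true  = 1
bit false = 0

record Decider (A : Ty) {P : ⟦ A ⟧ → Set} (P? : ∀ x → Dec (P x)) : Set where
  constructor decider
  field
    computes : PolyTime A nat (λ x → bit (does (P? x)))

open Decider

on : ∀ {A B f} {P : ⟦ B ⟧ → Set} {P? : ∀ y → Dec (P y)} → PolyTime A B f → Decider B P? → Decider A (λ x → P? (f x))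
on F D .computes = F ▸ computes D

equivalent : ∀ {A} {P Q : ⟦ A ⟧ → Set} {P? : ∀ x → Dec (P x)} {Q? : ∀ x → Dec (Q x)} →
  (∀ x → P x ⇔ Q x) → Decider A P? → Decider A Q?
equivalent {P? = P?} {Q?} P⇔Q D .computes =
  extensional (λ x → cong bit (does-⇔ (P⇔Q x) (P? x) (Q? x))) (computes D)

ifᶜ : ∀ {A B} {P : ⟦ A ⟧ → Set} {P? : ∀ x → Dec (P x)} {f g : ⟦ A ⟧ → ⟦ B ⟧} →
  Decider A P? → PolyTime A B f → PolyTime A B g →
  PolyTime A B (λ x → if does (P? x) then f x else g x)
ifᶜ {P? = P?} {f} {g} D F G = extensional branch
  (⟪ computes D , idᶜ ⟫ ▸ caseNatᶜ {f = g} {g = λ (_ , x) → f x} G (sndᶜ ▸ F))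
  where
  branch : ∀ x → natCase g (λ (_ , x) → f x) (bit (does (P? x)) , x) ≡ (if does (P? x) then f x else g x)
  branch x with does (P? x)
  ... | true  = refl
  ... | false = refl

isZeroᶜ : ∀ {A} {f : ⟦ A ⟧ → ℕ} → PolyTime A nat f → Decider A (λ x → f x ≟ 0)
isZeroᶜ {A} {f} F .computes = extensional isZero
  (⟪ F , numeral 0 ⟫ ▸ caseNatᶜ {A = nat} {f = λ _ → 1} {g = λ _ → 0} (numeral 1) (numeral 0))
  where
  isZero : ∀ x → natCase (λ _ → 1) (λ _ → 0) (f x , 0) ≡ bit (does (f x ≟ 0))
  isZero x with f x
  ... | zero  = refl
  ... | suc _ = refl

notᶜ : ∀ {A} {P : ⟦ A ⟧ → Set} {P? : ∀ x → Dec (P x)} → Decider A P? → Decider A (λ x → ¬? (P? x))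
notᶜ {P? = P?} D .computes = extensional negation (ifᶜ D (numeral 0) (numeral 1))
  where
  negation : ∀ x → (if does (P? x) then 0 else 1) ≡ bit (not (does (P? x)))
  negation x with does (P? x)
  ... | true  = refl
  ... | false = refl

andᶜ : ∀ {A} {P Q : ⟦ A ⟧ → Set} {P? : ∀ x → Dec (P x)} {Q? : ∀ x → Dec (Q x)} →
  Decider A P? → Decider A Q? → Decider A (λ x → P? x ×-dec Q? x)
andᶜ {P? = P?} {Q?} D E .computes = extensional conjunction (ifᶜ D (computes E) (numeral 0))
  where
  conjunction : ∀ x → (if does (P? x) then bit (does (Q? x)) else 0) ≡ bit (does (P? x) ∧ does (Q? x))
  conjunction x with does (P? x)
  ... | true  = refl
  ... | false = refl

filterᶜ : ∀ {X Γ} {P : ⟦ X ⊗ Γ ⟧ → Set} {P? : ∀ y → Dec (P y)} → Decider (X ⊗ Γ) P? →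
  PolyTime (list X ⊗ Γ) (list X) (λ (xs , γ) → filter (λ x → P? (x , γ)) xs)
filterᶜ {X} {Γ} {P? = P?} D = extensional (λ (xs , γ) → filter-is-foldr xs γ)
  (⟪ fstᶜ , ⟪ nilᶜ , sndᶜ ⟫ ⟫ ▸
    foldrᶜ (ifᶜ (on ⟪ fstᶜ , sndᶜ ▸ sndᶜ ⟫ D) (⟪ fstᶜ , sndᶜ ▸ fstᶜ ⟫ ▸ consᶜ) (sndᶜ ▸ fstᶜ))
      (con 1 ⊕ var) grows)
  where
  filter-is-foldr : ∀ xs γ →
    foldr (λ x ys → if does (P? (x , γ)) then x ∷ ys else ys) [] xs ≡ filter (λ x → P? (x , γ)) xs
  filter-is-foldr []       γ = refl
  filter-is-foldr (x ∷ xs) γ with does (P? (x , γ))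
  ... | true  = cong (x ∷_) (filter-is-foldr xs γ)
  ... | false = filter-is-foldr xs γ

  grows : ∀ x ys γ → size (list X) (if does (P? (x , γ)) then x ∷ ys else ys) ≤
    size (list X) ys + suc (size X x + size Γ γ)
  grows x ys γ with does (P? (x , γ))
  ... | true  = subst (_≤ size (list X) ys + suc (size X x + size Γ γ))
    (+-comm _ (suc (size X x))) (+-monoʳ-≤ (size (list X) ys) (s≤s (m≤m+n _ _)))
  ... | false = m≤m+n _ _

anyᶜ : ∀ {X Γ} {P : ⟦ X ⊗ Γ ⟧ → Set} {P? : ∀ y → Dec (P y)} → Decider (X ⊗ Γ) P? →
  Decider (list X ⊗ Γ) (λ (xs , γ) → any? (λ x → P? (x , γ)) xs)
anyᶜ {X} {Γ} {P? = P?} D .computes = extensional (λ (xs , γ) → any-is-foldr xs γ)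
  (⟪ fstᶜ , ⟪ numeral 0 , sndᶜ ⟫ ⟫ ▸
    foldrᶜ {S = nat} (ifᶜ (on ⟪ fstᶜ , sndᶜ ▸ sndᶜ ⟫ D) (numeral 1) (sndᶜ ▸ fstᶜ)) (con 1) grows)
  where
  any-is-foldr : ∀ xs γ →
    foldr (λ x k → if does (P? (x , γ)) then 1 else k) 0 xs ≡ bit (does (any? (λ x → P? (x , γ)) xs))
  any-is-foldr []       γ = refl
  any-is-foldr (x ∷ xs) γ with does (P? (x , γ))
  ... | true  = refl
  ... | false = any-is-foldr xs γ

  grows : ∀ x k γ → suc (if does (P? (x , γ)) then 1 else k) ≤ suc k + 1
  grows x k γ with does (P? (x , γ))
  ... | true  = s≤s (m≤n+m 1 k)
  ... | false = m≤m+n (suc k) 1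

mapᶜ : ∀ {X Γ B} {g : ⟦ X ⊗ Γ ⟧ → ⟦ B ⟧} → PolyTime (X ⊗ Γ) B g →
  PolyTime (list X ⊗ Γ) (list B) (λ (xs , γ) → map (λ x → g (x , γ)) xs)
mapᶜ {X} {Γ} {B} {g} F = extensional (λ (xs , γ) → sym (map-is-foldr {f = λ x → g (x , γ)} xs))
  (⟪ fstᶜ , ⟪ nilᶜ , sndᶜ ⟫ ⟫ ▸
    foldrᶜ (⟪ ⟪ fstᶜ , sndᶜ ▸ sndᶜ ⟫ ▸ F , sndᶜ ▸ fstᶜ ⟫ ▸ consᶜ)
      (con 1 ⊕ growth F ⊙ (con 1 ⊕ var))
      (λ x ys γ → subst (_≤ size (list B) ys + suc (eval (growth F) (suc (size X x + size Γ γ))))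
        (+-comm _ (suc (size B (g (x , γ)))))
        (+-monoʳ-≤ (size (list B) ys) (s≤s (size≤ F (x , γ))))))

appendᶜ : PolyTime (list A ⊗ list A) (list A) (λ (xs , ys) → xs ++ ys)
appendᶜ {A} = extensional (λ (xs , ys) → sym (++-is-foldr xs ys))
  (⟪ fstᶜ , ⟪ sndᶜ , numeral 0 ⟫ ⟫ ▸
    foldrᶜ {Γ = nat} {f = λ (x , xs , _) → x ∷ xs} (⟪ fstᶜ , sndᶜ ▸ fstᶜ ⟫ ▸ consᶜ) (con 1 ⊕ var)
      (λ x xs k → subst (_≤ size (list A) xs + suc (size A x + suc k))
        (+-comm _ (suc (size A x))) (+-monoʳ-≤ (size (list A) xs) (s≤s (m≤m+n _ _)))))

lengthᶜ : PolyTime (list A) nat length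
lengthᶜ = ⟪ idᶜ , ⟪ numeral 0 , numeral 0 ⟫ ⟫ ▸
  foldrᶜ {S = nat} {Γ = nat} {f = λ (_ , k , _) → suc k} (sndᶜ ▸ fstᶜ ▸ sucᶜ) (con 1)
    (λ _ k _ → ≤-reflexive (+-comm 1 (suc k)))

predᶜ : PolyTime nat nat pred
predᶜ = extensional {f = λ k → natCase (λ _ → 0) proj₁ (k , 0)} (λ { zero → refl ; (suc _) → refl })
  (⟪ idᶜ , numeral 0 ⟫ ▸ caseNatᶜ {A = nat} (numeral 0) fstᶜ)

-- Bounded iteration as a fold over a list of dummies. `entry` and `ball` are defined by exactly
-- this fold, so that they compile without a further equation.
iterateᶜ : ∀ {f : ⟦ S ⊗ Γ ⟧ → ⟦ S ⟧} → PolyTime (S ⊗ Γ) S f → (G : Polynomial) →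
  (∀ s γ → size S (f (s , γ)) ≤ size S s + eval G (size Γ γ)) →
  PolyTime (nat ⊗ S ⊗ Γ) S (λ (k , s , γ) → foldr (λ _ s → f (s , γ)) s (replicate k 0))
iterateᶜ {S} {Γ} F G f-grows =
  ⟪ ⟪ fstᶜ , numeral 0 ⟫ ▸ replicateᶜ , sndᶜ ⟫ ▸
  foldrᶜ {X = nat} (sndᶜ ▸ F) G
    (λ x s γ → ≤-trans (f-grows s γ) (+-monoʳ-≤ (size S s) (eval-mono G (m≤n+m (size Γ γ) (suc x)))))

monusᶜ : PolyTime (nat ⊗ nat) nat (λ (m , n) → m ∸ n)
monusᶜ = extensional (λ (m , n) → monus m n)
  (⟪ sndᶜ , ⟪ fstᶜ , numeral 0 ⟫ ⟫ ▸
    iterateᶜ {S = nat} {Γ = nat} {f = λ (k , _) → pred k} (fstᶜ ▸ predᶜ) (con 0)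
      (λ k _ → m≤n⇒m≤n+o 0 (s≤s (pred[n]≤n {k}))))
  where
  monus : ∀ m n → foldr (λ _ k → pred k) m (replicate n 0) ≡ m ∸ n
  monus m zero    = refl
  monus m (suc n) = trans (cong pred (monus m n)) (pred[m∸n]≡m∸[1+n] m n)

leqᶜ : Decider (nat ⊗ nat) (λ (m , n) → m ≤? n)
leqᶜ = equivalent (λ (m , n) → mk⇔ (m∸n≡0⇒m≤n {m}) m≤n⇒m∸n≡0) (isZeroᶜ monusᶜ)

equalᶜ : Decider (nat ⊗ nat) (λ (m , n) → m ≟ n)
equalᶜ = equivalent
  (λ (m , n) → mk⇔ (λ (m≤n , n≤m) → ≤-antisym m≤n n≤m) (λ m≡n → ≤-reflexive m≡n , ≤-reflexive (sym m≡n)))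
  (andᶜ leqᶜ (on ⟪ sndᶜ , fstᶜ ⟫ leqᶜ))

headOr : ∀ {A : Set} → A → List A → A
headOr z []      = z
headOr z (x ∷ _) = x

headOrᶜ : PolyTime (A ⊗ list A) A (λ (z , xs) → headOr z xs)
headOrᶜ = extensional
  {f = λ (z , xs) → listCase (λ z → z) (λ ((x , _) , _) → x) (xs , z)}
  (λ { (_ , []) → refl ; (_ , _ ∷ _) → refl })
  (⟪ sndᶜ , fstᶜ ⟫ ▸ caseListᶜ idᶜ (fstᶜ ▸ fstᶜ))

tailOr[] : ∀ {A : Set} → List A → List A
tailOr[] []       = []
tailOr[] (_ ∷ xs) = xs

-- Out of range, the entry is z.
entry : ∀ {A : Set} → A → List A → ℕ → A
entry z xs i = headOr z (foldr (λ _ → tailOr[]) xs (replicate i 0))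

entryᶜ : PolyTime (A ⊗ list A ⊗ nat) A (λ (z , xs , i) → entry z xs i)
entryᶜ {A} = ⟪ fstᶜ , ⟪ sndᶜ ▸ sndᶜ , ⟪ sndᶜ ▸ fstᶜ , numeral 0 ⟫ ⟫ ▸
    iterateᶜ {Γ = nat} {f = λ (xs , _) → tailOr[] xs} (fstᶜ ▸ tailᶜ) (con 0) (λ xs _ → m≤n⇒m≤n+o 0 (shrinks xs)) ⟫
  ▸ headOrᶜ
  where
  tailᶜ : PolyTime (list A) (list A) tailOr[]
  tailᶜ = extensional
    {f = λ xs → listCase (λ _ → []) (λ ((_ , xs) , _) → xs) (xs , 0)}
    (λ { [] → refl ; (_ ∷ _) → refl })
    (⟪ idᶜ , numeral 0 ⟫ ▸ caseListᶜ {A = nat} nilᶜ (fstᶜ ▸ sndᶜ))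

  shrinks : ∀ (xs : List ⟦ A ⟧) → size (list A) (tailOr[] xs) ≤ size (list A) xs
  shrinks []       = ≤-refl
  shrinks (x ∷ xs) = m≤n⇒m≤1+n (m≤n+m _ _)

-- The length of the list built so far serves as the counter: pushing it repeatedly yields
-- `downFrom`, which is then reversed.
upToᶜ : PolyTime nat (list nat) upTo
upToᶜ = extensional (λ n → trans (cong reverse (countdown n ≤-refl)) (reverse-downFrom n))
  (⟪ idᶜ , ⟪ nilᶜ , idᶜ ⟫ ⟫ ▸
   iterateᶜ (ifᶜ (on ⟪ fstᶜ ▸ lengthᶜ , sndᶜ ⟫ leqᶜ)
     (⟪ fstᶜ ▸ lengthᶜ , fstᶜ ⟫ ▸ consᶜ) fstᶜ) (con 1 ⊕ var) push-grows
   ▸ reverseᶜ)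
  where
  -- The test never fails below, but makes the growth independent of the list.
  push : List ℕ → ℕ → List ℕ
  push ks n = if does (length ks ≤? n) then length ks ∷ ks else ks

  push-grows : ∀ ks n → size (list nat) (push ks n) ≤ size (list nat) ks + suc (suc n)
  push-grows ks n with length ks ≤ᵇ n in eq
  ... | true  = subst (_≤ size (list nat) ks + suc (suc n)) (+-comm _ (suc (suc (length ks))))
    (+-monoʳ-≤ (size (list nat) ks) (s≤s (s≤s (≤ᵇ⇒≤ _ _ (subst T (sym eq) _)))))
  ... | false = m≤m+n _ _

  countdown : ∀ n {j} → j ≤ n → foldr (λ _ ks → push ks n) [] (replicate j 0) ≡ downFrom j
  countdown n {zero}  j≤n = refl
  countdown n {suc j} j<n = begin
    push (foldr (λ _ ks → push ks n) [] (replicate j 0)) n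
      ≡⟨ cong (λ ks → push ks n) (countdown n (<⇒≤ j<n)) ⟩
    (if does (length (downFrom j) ≤? n) then length (downFrom j) ∷ downFrom j else downFrom j)
      ≡⟨ cong (λ k → if does (k ≤? n) then k ∷ downFrom j else downFrom j) (length-downFrom j) ⟩
    (if does (j ≤? n) then j ∷ downFrom j else downFrom j)
      ≡⟨ cong (λ b → if b then j ∷ downFrom j else downFrom j) (dec-true (j ≤? n) (<⇒≤ j<n)) ⟩
    downFrom (suc j) ∎
    where open ≡-Reasoning

-- The algorithm

module Algorithm {V : Set} {E : V → V → Set}
  (_≟ⱽ_ : DecidableEquality V) (E? : ∀ u v → Dec (E u v)) (vs : List V) (root : V) where

  member? : ∀ v S → Dec (Any (v ≡_) S)
  member? v S = any? (v ≟ⱽ_) S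

  New : List V → V → Set
  New S v = ¬ Any (v ≡_) S × Any (λ w → E w v) S

  new? : ∀ S v → Dec (New S v)
  new? S v = ¬? (member? v S) ×-dec any? (λ w → E? w v) S

  expand : List V → List V
  expand S = S ++ filter (new? S) vs

  -- Breadth-first search. New vertices are appended at the end, so the list is sorted by distance
  -- from `u`.
  ball : V → ℕ → List V
  ball u t = foldr (λ _ → expand) [ u ] (replicate t 0)

  -- Distances are smaller than the number of vertices, so this radius reaches the whole graph.
  order : List V
  order = ball root (length vs)

  close? : ∀ r v ps → Dec (Any (λ p → Any (v ≡_) (ball p (r + r))) ps)
  close? r v ps = any? (λ p → member? v (ball p (r + r))) ps

  insert : ℕ → V → List V → List V
  insert r v ps = if does (close? r v ps) then ps else v ∷ ps

  -- The list order increases away from the root and foldr starts at its end.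
  picks : ℕ → List V
  picks r = foldr (insert r) [] order

  -- Since `order` is sorted, the head is a vertex closest to the root among those within `r` of
  -- `p`. It is at least as close to the root as the vertex `r` steps before `p` on a geodesic, and
  -- no path has to be computed to find it.
  centre : ℕ → V → V
  centre r p = headOr root (filter (λ x → member? x (ball p r)) order)

  radius : ℕ
  radius = headOr 0 (filter (λ r → length (picks r) ≤? suc r) (upTo (length vs)))

  -- The repeated `root` fills the `radius + k` rounds during which even the centre activated last
  -- still has time to spread.
  schedule : ℕ → List V
  schedule k = map (centre radius) (picks radius) ++ replicate (radius + k) root

-- The algorithm compiled for adjacency matrices

edge? : ∀ (M : List (List ℕ)) u v → Dec (¬ entry 0 (entry [] M u) v ≡ 0)
edge? M u v = ¬? (entry 0 (entry [] M u) v ≟ 0)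

size-++ : ∀ {A} (xs ys : List ⟦ A ⟧) → size (list A) (xs ++ ys) ≤ size (list A) xs + size (list A) ys
size-++ []           ys = n≤1+n _
size-++ {A} (x ∷ xs) ys = s≤s (≤-trans (+-monoʳ-≤ (size A x) (size-++ {A} xs ys))
  (≤-reflexive (sym (+-assoc (size A x) _ _))))

size-filter : ∀ {A} {P : ⟦ A ⟧ → Set} (P? : ∀ x → Dec (P x)) xs →
  size (list A) (filter P? xs) ≤ size (list A) xs
size-filter P? [] = ≤-refl
size-filter {A} P? (x ∷ xs) with does (P? x)
... | true  = s≤s (+-monoʳ-≤ (size A x) (size-filter {A} P? xs))
... | false = m≤n⇒m≤1+n (m≤n⇒m≤o+n (size A x) (size-filter {A} P? xs))

module MatrixAlgorithm (M : List (List ℕ)) = Algorithm _≟_ (edge? M) (upTo (length M)) 0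

module _ where

  open MatrixAlgorithm

  edgeᶜ : Decider (nat ⊗ nat ⊗ Matrix) (λ (u , v , M) → edge? M u v)
  edgeᶜ = notᶜ (isZeroᶜ
    (⟪ numeral 0 , ⟪ ⟪ nilᶜ , ⟪ sndᶜ ▸ sndᶜ , fstᶜ ⟫ ⟫ ▸ entryᶜ , sndᶜ ▸ fstᶜ ⟫ ⟫ ▸ entryᶜ))

  memberᶜ : Decider (nat ⊗ list nat) (λ (v , S) → any? (v ≟_) S)
  memberᶜ = on ⟪ sndᶜ , fstᶜ ⟫ (anyᶜ (on ⟪ sndᶜ , fstᶜ ⟫ equalᶜ))

  newᶜ : Decider (nat ⊗ list nat ⊗ Matrix) (λ (v , S , M) → new? M S v)
  newᶜ = andᶜ
    (notᶜ (on ⟪ fstᶜ , sndᶜ ▸ fstᶜ ⟫ memberᶜ))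
    (on ⟪ sndᶜ ▸ fstᶜ , ⟪ fstᶜ , sndᶜ ▸ sndᶜ ⟫ ⟫ (anyᶜ edgeᶜ))

  verticesᶜ : PolyTime Matrix (list nat) (λ M → upTo (length M))
  verticesᶜ = lengthᶜ ▸ upToᶜ

  expandᶜ : PolyTime (list nat ⊗ Matrix) (list nat) (λ (S , M) → expand M S)
  expandᶜ = ⟪ fstᶜ , ⟪ sndᶜ ▸ verticesᶜ , idᶜ ⟫ ▸ filterᶜ newᶜ ⟫ ▸ appendᶜ

  ballᶜ : PolyTime (nat ⊗ nat ⊗ Matrix) (list nat) (λ (t , u , M) → ball M u t)
  ballᶜ = ⟪ fstᶜ , ⟪ ⟪ sndᶜ ▸ fstᶜ , nilᶜ ⟫ ▸ consᶜ , sndᶜ ▸ sndᶜ ⟫ ⟫ ▸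
    -- Each round appends a sublist of the vertex list, whose size depends on the matrix alone; this
    -- makes the growth additive.
    iterateᶜ expandᶜ (growth verticesᶜ) (λ S M →
      ≤-trans (size-++ {nat} S (filter (new? M S) (upTo (length M))))
        (+-monoʳ-≤ (size (list nat) S)
          (≤-trans (size-filter {nat} (new? M S) (upTo (length M))) (size≤ verticesᶜ M))))

  orderᶜ : PolyTime Matrix (list nat) order
  orderᶜ = ⟪ verticesᶜ ▸ lengthᶜ , ⟪ numeral 0 , idᶜ ⟫ ⟫ ▸ ballᶜ

  addᶜ : PolyTime (nat ⊗ nat) nat (λ (m , n) → m + n)
  addᶜ = extensional (λ (m , n) → plus m n)
    (⟪ fstᶜ , ⟪ sndᶜ , numeral 0 ⟫ ⟫ ▸
      iterateᶜ {S = nat} {Γ = nat} {f = λ (k , _) → suc k} (fstᶜ ▸ sucᶜ) (con 1)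
        (λ k _ → ≤-reflexive (+-comm 1 (suc k))))
    where
    plus : ∀ m n → foldr (λ _ k → suc k) n (replicate m 0) ≡ m + n
    plus zero    n = refl
    plus (suc m) n = cong suc (plus m n)

  closeᶜ : Decider (nat ⊗ nat ⊗ list nat ⊗ Matrix) (λ (r , v , ps , M) → close? M r v ps)
  closeᶜ = on ⟪ sndᶜ ▸ sndᶜ ▸ fstᶜ , ⟪ fstᶜ , ⟪ sndᶜ ▸ fstᶜ , sndᶜ ▸ sndᶜ ▸ sndᶜ ⟫ ⟫ ⟫
    (anyᶜ {Γ = nat ⊗ nat ⊗ Matrix} {P? = λ (p , r , v , M) → member? M v (ball M p (r + r))}
      (on ⟪ sndᶜ ▸ sndᶜ ▸ fstᶜ ,
          ⟪ ⟪ sndᶜ ▸ fstᶜ , sndᶜ ▸ fstᶜ ⟫ ▸ addᶜ , ⟪ fstᶜ , sndᶜ ▸ sndᶜ ▸ sndᶜ ⟫ ⟫ ▸ ballᶜ ⟫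
        memberᶜ))

  picksᶜ : PolyTime (nat ⊗ Matrix) (list nat) (λ (r , M) → picks M r)
  picksᶜ = ⟪ sndᶜ ▸ orderᶜ , ⟪ nilᶜ , idᶜ ⟫ ⟫ ▸
    foldrᶜ {f = λ (v , ps , r , M) → insert M r v ps}
      (ifᶜ (on ⟪ sndᶜ ▸ sndᶜ ▸ fstᶜ , ⟪ fstᶜ , ⟪ sndᶜ ▸ fstᶜ , sndᶜ ▸ sndᶜ ▸ sndᶜ ⟫ ⟫ ⟫ closeᶜ)
        (sndᶜ ▸ fstᶜ) (⟪ fstᶜ , sndᶜ ▸ fstᶜ ⟫ ▸ consᶜ))
      (con 1 ⊕ var) grows
    where
    grows : ∀ v ps (γ : ⟦ nat ⊗ Matrix ⟧) → size (list nat) (insert (proj₂ γ) (proj₁ γ) v ps) ≤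
      size (list nat) ps + suc (suc v + size (nat ⊗ Matrix) γ)
    grows v ps (r , M) with does (close? M r v ps)
    ... | true  = m≤m+n _ _
    ... | false = subst (_≤ size (list nat) ps + suc (suc v + size (nat ⊗ Matrix) (r , M)))
      (+-comm _ (suc (suc v))) (+-monoʳ-≤ (size (list nat) ps) (s≤s (m≤m+n _ _)))

  centreᶜ : PolyTime (nat ⊗ nat ⊗ Matrix) nat (λ (p , r , M) → centre M r p)
  centreᶜ = ⟪ numeral 0 , ⟪ sndᶜ ▸ sndᶜ ▸ orderᶜ , idᶜ ⟫ ▸
    filterᶜ {Γ = nat ⊗ nat ⊗ Matrix} {P? = λ (x , p , r , M) → member? M x (ball M p r)}
      (on ⟪ fstᶜ , ⟪ sndᶜ ▸ sndᶜ ▸ fstᶜ , ⟪ sndᶜ ▸ fstᶜ , sndᶜ ▸ sndᶜ ▸ sndᶜ ⟫ ⟫ ▸ ballᶜ ⟫ memberᶜ) ⟫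
    ▸ headOrᶜ

  radiusᶜ : PolyTime Matrix nat radius
  radiusᶜ = ⟪ numeral 0 , ⟪ verticesᶜ ▸ lengthᶜ ▸ upToᶜ , idᶜ ⟫ ▸
    filterᶜ {P? = λ (r , M) → length (picks M r) ≤? suc r} (on ⟪ picksᶜ ▸ lengthᶜ , fstᶜ ▸ sucᶜ ⟫ leqᶜ) ⟫
    ▸ headOrᶜ

  scheduleᶜ : ∀ k → PolyTime Matrix (list nat) (λ M → Algorithm.schedule _≟_ (edge? M) (upTo (length M)) 0 k)
  scheduleᶜ k =
    ⟪ ⟪ ⟪ radiusᶜ , idᶜ ⟫ ▸ picksᶜ , ⟪ radiusᶜ , idᶜ ⟫ ⟫ ▸ mapᶜ centreᶜ ,
      ⟪ ⟪ radiusᶜ , numeral k ⟫ ▸ addᶜ , numeral 0 ⟫ ▸ replicateᶜ ⟫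
    ▸ appendᶜ

-- Distances

least : ∀ {P : ℕ → Set} → (∀ k → Dec (P k)) → ∀ m → P m → ∃[ k ] IsMinimum P k
least P? m Pm with P? 0
... | yes P0 = 0 , P0 , λ _ _ → z≤n
least P? zero    Pm | no ¬P0 = contradiction Pm ¬P0
least P? (suc m) Pm | no ¬P0 with least (P? ∘ suc) m Pm
... | k , Pk , k≤ = suc k , Pk , λ { zero P0 → contradiction P0 ¬P0 ; (suc j) Pj → s≤s (k≤ j Pj) }

minimum-unique : ∀ {P : ℕ → Set} {j k} → IsMinimum P j → IsMinimum P k → j ≡ k
minimum-unique (Pj , j≤) (Pk , k≤) = ≤-antisym (j≤ _ Pk) (k≤ _ Pj)

module _ {n : ℕ} (G : Graph n) where

  edge-sym : ∀ {u v} → Edge G u v → Edge G v u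
  edge-sym {u} {v} = subst T (adj-sym G u v)

  WalkOf : ℕ → Fin n → Fin n → Set
  WalkOf k u v = ∃[ w ] walkLength G {u} {v} w ≡ k

  walkOf? : ∀ k u v → Dec (WalkOf k u v)
  walkOf? zero    u v = map′ (λ { refl → ε , refl }) (λ { (ε , _) → refl }) (u Fin.≟ v)
  walkOf? (suc k) u v = map′
    (λ { (_ , e , w , eq) → e ◅ w , cong suc eq })
    (λ { (e ◅ w , eq) → _ , e , w , suc-injective eq })
    (Fin.any? λ x → T? (adj G u x) ×-dec walkOf? k x v)

  walkOf-trans : ∀ {j k u v w} → WalkOf j u v → WalkOf k v w → WalkOf (j + k) u w
  walkOf-trans (ε , refl)     q = q
  walkOf-trans (e ◅ p , refl) q with walkOf-trans (p , refl) q
  ... | r , eq = e ◅ r , cong suc eq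

  walkOf-sym : ∀ {k u v} → WalkOf k u v → WalkOf k v u
  walkOf-sym (ε , refl)             = ε , refl
  walkOf-sym {u = u} {v} (e ◅ p , refl) = subst (λ k → WalkOf k v u) (+-comm _ 1)
    (walkOf-trans (walkOf-sym (p , refl)) (edge-sym e ◅ ε , refl))

module Distance {n : ℕ} (G : Graph n) (walk : ∀ u v → Walk G u v) where

  private
    distance : ∀ u v → ∃[ k ] IsDistance G u v k
    distance u v = least (λ k → walkOf? G k u v) (walkLength G (walk u v)) (walk u v , refl)

  abstract
    d : Fin n → Fin n → ℕ
    d u v = proj₁ (distance u v)

    d-isDistance : ∀ u v → IsDistance G u v (d u v)
    d-isDistance u v = proj₂ (distance u v)

  geodesic : ∀ u v → WalkOf G (d u v) u v
  geodesic u v = proj₁ (d-isDistance u v)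

  d≤ : ∀ {k u v} → WalkOf G k u v → d u v ≤ k
  d≤ {u = u} {v} = proj₂ (d-isDistance u v) _

  d-unique : ∀ {u v k} → IsDistance G u v k → d u v ≡ k
  d-unique = minimum-unique (d-isDistance _ _)

  d-refl : ∀ u → d u u ≡ 0
  d-refl u = n≤0⇒n≡0 (d≤ (ε , refl))

  d-sym : ∀ u v → d u v ≡ d v u
  d-sym u v = ≤-antisym (d≤ (walkOf-sym G (geodesic v u))) (d≤ (walkOf-sym G (geodesic u v)))

  d-triangle : ∀ u v w → d u w ≤ d u v + d v w
  d-triangle u v w = d≤ (walkOf-trans G (geodesic u v) (geodesic v w))

  d-edge : ∀ {u v} → Edge G u v → d u v ≤ 1
  d-edge e = d≤ (e ◅ ε , refl)

  d≡0⇒≡ : ∀ {u v} → d u v ≡ 0 → u ≡ v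
  d≡0⇒≡ {u} {v} duv≡0 with geodesic u v
  ... | ε , _      = refl
  ... | _ ◅ _ , eq = contradiction (trans eq duv≡0) λ ()

  first-step : ∀ {u v k} → d u v ≡ suc k → ∃[ w ] (Edge G u w × d w v ≡ k)
  first-step {u} {v} {k} duv with geodesic u v
  ... | ε , eq                = contradiction (trans eq duv) λ ()
  ... | _◅_ {j = w} e p , eq  = w , e , ≤-antisym
    (d≤ (p , suc-injective (trans eq duv)))
    (≤-pred (subst (_≤ suc (d w v)) duv (≤-trans (d-triangle u w v) (+-monoˡ-≤ (d w v) (d-edge e)))))

  last-step : ∀ {u v k} → d u v ≡ suc k → ∃[ w ] (d u w ≡ k × Edge G w v)
  last-step {u} {v} duv with first-step (trans (d-sym v u) duv)
  ... | w , e , dwu = w , trans (d-sym u w) dwu , edge-sym G e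

  Between : Fin n → Fin n → Fin n → Set
  Between u v x = d u x + d x v ≡ d u v

  between? : ∀ u v x → Dec (Between u v x)
  between? u v x = d u x + d x v ≟ d u v

  point-at : ∀ u v {j} → j ≤ d u v → ∃[ x ] (d u x ≡ j × Between u v x)
  point-at u v {zero}  _ = u , d-refl u , cong (_+ d u v) (d-refl u)
  point-at u v {suc j} j<d with point-at u v (<⇒≤ j<d)
  ... | x , dux , btw with d x v in dxv
  ... | zero  = contradiction j<d (≤⇒≯ (≤-reflexive
    (trans (sym btw) (trans (+-identityʳ _) dux))))
  ... | suc k with first-step dxv
  ... | w , e , dwv = w , duw , trans (cong₂ _+_ duw dwv) total
    where
    total : suc j + k ≡ d u v
    total = trans (sym (+-suc j k)) (trans (cong (_+ suc k) (sym dux)) btw)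

    -- From above by the step from `x` to `w`; from below because a shorter way to `w` would
    -- continue to a walk to `v` shorter than `d u v`.
    duw : d u w ≡ suc j
    duw = ≤-antisym
      (≤-trans (d-triangle u x w) (≤-trans (+-mono-≤ (≤-reflexive dux) (d-edge e)) (≤-reflexive (+-comm j 1))))
      (+-cancelʳ-≤ k (suc j) (d u w) (subst₂ _≤_ (sym total) (cong (d u w +_) dwv) (d-triangle u w v)))

  -- Pigeonhole: between `u` and `v` there is a vertex at each distance from 0 to `d u v`, and these
  -- vertices are distinct.
  d<n : ∀ u v → d u v < n
  d<n u v = Fin.injective⇒≤ {f = at} at-injective
    where
    at′ : ∀ (i : Fin (suc (d u v))) → ∃[ x ] (d u x ≡ toℕ i × Between u v x)
    at′ i = point-at u v (≤-pred (Fin.toℕ<n i))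

    at : Fin (suc (d u v)) → Fin n
    at i = proj₁ (at′ i)

    at-injective : ∀ {i j} → at i ≡ at j → i ≡ j
    at-injective {i} {j} eq = Fin.toℕ-injective (trans (sym (proj₁ (proj₂ (at′ i))))
      (trans (cong (d u) eq) (proj₁ (proj₂ (at′ j)))))

-- Burning and packings

index-++ : ∀ {V : Set} {x : V} {xs} ys → x ∈ xs →
  ∃[ i ] (Vec.lookup (fromList (xs ++ ys)) i ≡ x × toℕ i < length xs)
index-++ ys (here refl) = zero , refl , s≤s z≤n
index-++ ys (there x∈) with index-++ ys x∈
... | i , eq , i< = suc i , eq , s≤s i<

module Burning {n : ℕ} (G : Graph n) (walk : ∀ u v → Walk G u v) where

  open Distance G walk

  -- Index `i` is activated in round `suc (toℕ i)`; the additive form of the distance bound avoids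
  -- truncated subtraction.
  burned⇒near : ∀ {m} {as : Vec (Fin n) m} {r v} → Burned G as r v →
    ∃[ i ] d (Vec.lookup as i) v + suc (toℕ i) ≤ r
  burned⇒near (activate i) = i , +-monoˡ-≤ (suc (toℕ i)) (≤-reflexive (d-refl _))
  burned⇒near (stay b) = Product.map₂ m≤n⇒m≤1+n (burned⇒near b)
  burned⇒near {as = as} (spread {u = u} {v} e b) with burned⇒near b
  ... | i , near = i , ≤-trans (+-monoˡ-≤ (suc (toℕ i))
    (≤-trans (d-triangle (Vec.lookup as i) u v) (≤-trans (+-monoʳ-≤ _ (d-edge e)) (≤-reflexive (+-comm _ 1)))))
    (s≤s near)

  burned-along : ∀ {m} {as : Vec (Fin n) m} {r k u v} → Burned G as r u → WalkOf G k u v → Burned G as (k + r) v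
  burned-along b (ε , refl)     = b
  burned-along {as = as} {r} {v = v} b (e ◅ w , refl) =
    subst (λ t → Burned G as t v) (+-suc _ r) (burned-along (spread e b) (w , refl))

  burned-later : ∀ {m} {as : Vec (Fin n) m} {r t v} → r ≤ t → Burned G as r v → Burned G as t v
  burned-later {as = as} {v = v} r≤t b = go (≤⇒≤′ r≤t)
    where
    go : ∀ {t} → _ ≤′ t → Burned G as t v
    go ≤′-refl       = b
    go (≤′-step r≤t) = stay (go r≤t)

  near⇒burned : ∀ {m} {as : Vec (Fin n) m} {v} i → d (Vec.lookup as i) v + suc (toℕ i) ≤ m → Burned G as m v
  near⇒burned {as = as} {v} i near = burned-later near (burned-along (activate i) (geodesic (Vec.lookup as i) v))

  -- The fire of an activator spreads for at most `r` rounds, the first of the `suc r` rounds being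
  -- its earliest activation. Two points burned by the same activator are thus within `r + r`, so
  -- separated points need distinct activators.
  packing : ∀ {r k} {as : Vec (Fin n) (suc r)} → Burns G as → (points : Fin k → Fin n) →
    (∀ {i j} → i ≢ j → r + r < d (points i) (points j)) → k ≤ suc r
  packing {r} {k} {as} burns points separated = Fin.injective⇒≤ {f = λ i → proj₁ (activator i)} activator-injective
    where
    activator : ∀ i → ∃[ a ] d (Vec.lookup as a) (points i) + suc (toℕ a) ≤ suc r
    activator i = burned⇒near (burns (points i))

    close : ∀ i → d (Vec.lookup as (proj₁ (activator i))) (points i) ≤ r
    close i = ≤-pred (≤-trans (≤-reflexive (+-comm 1 _))
      (≤-trans (+-monoʳ-≤ _ (s≤s z≤n)) (proj₂ (activator i))))

    activator-injective : ∀ {i j} → proj₁ (activator i) ≡ proj₁ (activator j) → i ≡ j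
    activator-injective {i} {j} eq with i Fin.≟ j
    ... | yes i≡j = i≡j
    ... | no i≢j  = contradiction
      (≤-trans (d-triangle (points i) (Vec.lookup as (proj₁ (activator i))) (points j))
        (+-mono-≤ (subst (_≤ r) (d-sym _ (points i)) (close i))
                  (subst (λ a → d (Vec.lookup as a) (points j) ≤ r) (sym eq) (close j))))
      (<⇒≱ (separated i≢j))

  -- Activating every vertex once suffices. This places `b - 1` in the range over which `radius` is
  -- searched.
  burningNumber≤ : ∀ {b} → IsBurningNumber G b → b ≤ n
  burningNumber≤ (_ , b≤) = b≤ n (Vec.tabulate (λ v → v) , λ v → near⇒burned v
    (subst (λ u → d u v + suc (toℕ v) ≤ n) (sym (lookup∘tabulate (λ v → v) v))
      (≤-trans (+-monoˡ-≤ (suc (toℕ v)) (≤-reflexive (d-refl v))) (Fin.toℕ<n v))))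

  -- b + 1 points at mutual distance at least 2 b along a geodesic would contradict packing.
  diameter< : ∀ {b} {as : Vec (Fin n) b} → Burns G as → ∀ u v → d u v < b * (b + b)
  diameter< {zero} burns u v with burned⇒near (burns u)
  ... | () , _
  diameter< {suc r} {as} burns u v = ≰⇒> λ far →
    contradiction (packing burns (points far) (separated far)) (n≮n (suc r))
    where
    -- Larger than `r + r`, and chosen so that `suc r * gap` is literally `b * (b + b)`.
    gap : ℕ
    gap = suc r + suc r

    module _ (far : suc r * gap ≤ d u v) where
      point : ∀ (i : Fin (suc (suc r))) → ∃[ x ] (d u x ≡ toℕ i * gap × Between u v x)
      point i = point-at u v (≤-trans (*-monoˡ-≤ gap (≤-pred (Fin.toℕ<n i))) far)

      points : Fin (suc (suc r)) → Fin n
      points i = proj₁ (point i)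

      apart : ∀ {i j} → toℕ i < toℕ j → r + r < d (points i) (points j)
      apart {i} {j} i<j = ≤-trans (s≤s (≤-trans (n≤1+n _) (≤-reflexive (sym (+-suc r r)))))
        (+-cancelˡ-≤ (toℕ i * gap) _ _ (begin
          toℕ i * gap + gap                  ≡⟨ +-comm (toℕ i * gap) gap ⟩
          suc (toℕ i) * gap                   ≤⟨ *-monoˡ-≤ gap i<j ⟩
          toℕ j * gap                         ≡⟨ proj₁ (proj₂ (point j)) ⟨
          d u (points j)                       ≤⟨ d-triangle u (points i) (points j) ⟩
          d u (points i) + d (points i) (points j) ≡⟨ cong (_+ d (points i) (points j)) (proj₁ (proj₂ (point i))) ⟩
          toℕ i * gap + d (points i) (points j) ∎))
        where open ≤-Reasoning

      separated : ∀ {i j} → i ≢ j → r + r < d (points i) (points j)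
      separated {i} {j} i≢j with <-cmp (toℕ i) (toℕ j)
      ... | tri< i<j _ _ = apart i<j
      ... | tri≈ _ i≡j _ = contradiction (Fin.toℕ-injective i≡j) i≢j
      ... | tri> _ _ j<i = subst (r + r <_) (d-sym (points j) (points i)) (apart j<i)

  -- Every entry of `cs` is activated by round `length cs`, which leaves it at least `t` rounds
  -- wherever in `cs` it stands.
  cover-burns : ∀ cs t z → (∀ v → ∃[ c ] (c ∈ cs × d c v ≤ t)) → Burns G (fromList (cs ++ replicate t z))
  cover-burns cs t z cover v with cover v
  ... | c , c∈ , near with index-++ (replicate t z) c∈
  ... | i , eq , i< = near⇒burned i (begin
    d (Vec.lookup (fromList (cs ++ replicate t z)) i) v + suc (toℕ i)
      ≡⟨ cong (λ c → d c v + suc (toℕ i)) eq ⟩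
    d c v + suc (toℕ i)
      ≤⟨ +-mono-≤ near i< ⟩
    t + length cs
      ≡⟨ +-comm t (length cs) ⟩
    length cs + t
      ≡⟨ cong (length cs +_) (length-replicate t) ⟨
    length cs + length (replicate t z)
      ≡⟨ length-++ cs ⟨
    length (cs ++ replicate t z) ∎)
    where open ≤-Reasoning

-- Correctness of the algorithm

module _ {V : Set} {R : V → V → Set} where

  pairwise⇒AllPairs : ∀ {xs} → (∀ {x y} → x ∈ xs → y ∈ xs → R x y) → AllPairs R xs
  pairwise⇒AllPairs {[]}     r = []
  pairwise⇒AllPairs {x ∷ xs} r =
    All.tabulate (λ y∈ → r (here refl) (there y∈)) ∷ pairwise⇒AllPairs (λ y∈ z∈ → r (there y∈) (there z∈))

  AllPairs-lookup : Symmetric R → ∀ {xs} → AllPairs R xs → ∀ {i j} → i ≢ j → R (lookup xs i) (lookup xs j)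
  AllPairs-lookup R-sym (_ ∷ _)  {zero}  {zero}  i≢j = contradiction refl i≢j
  AllPairs-lookup R-sym (r ∷ _)  {zero}  {suc j} i≢j = All.lookup r (∈-lookup j)
  AllPairs-lookup R-sym (r ∷ _)  {suc i} {zero}  i≢j = R-sym (All.lookup r (∈-lookup i))
  AllPairs-lookup R-sym (_ ∷ rs) {suc i} {suc j} i≢j = AllPairs-lookup R-sym rs (i≢j ∘ cong suc)

  headOr-least : Reflexive R → ∀ z {xs x} → AllPairs R xs → x ∈ xs → R (headOr z xs) x
  headOr-least R-refl z (_ ∷ _) (here refl) = R-refl
  headOr-least R-refl z (r ∷ _) (there x∈)  = All.lookup r x∈

headOr-∈ : ∀ {V : Set} (z : V) {xs x} → x ∈ xs → headOr z xs ∈ xs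
headOr-∈ z {_ ∷ _} _ = here refl

module Correctness {n : ℕ} (G : Graph n) (walk : ∀ u v → Walk G u v)
  (vs : List (Fin n)) (complete : ∀ v → v ∈ vs) (n≤length : n ≤ length vs) (root : Fin n) where

  open Distance G walk
  open Burning G walk
  open Algorithm Fin._≟_ (λ u v → T? (adj G u v)) vs root

  ∈-ball⁻ : ∀ {u v} t → v ∈ ball u t → d u v ≤ t
  ∈-ball⁻ {u} zero (here refl) = ≤-reflexive (d-refl u)
  ∈-ball⁻ {u} {v} (suc t) v∈ with ∈-++⁻ (ball u t) v∈
  ... | inj₁ v∈ball = m≤n⇒m≤1+n (∈-ball⁻ t v∈ball)
  ... | inj₂ v∈new with find (proj₂ (proj₂ (∈-filter⁻ (new? (ball u t)) {xs = vs} v∈new)))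
  ... | w , w∈ball , e = ≤-trans (d-triangle u w v)
    (≤-trans (+-mono-≤ (∈-ball⁻ t w∈ball) (d-edge e)) (≤-reflexive (+-comm t 1)))

  ∈-ball⁺ : ∀ {u v} t → d u v ≤ t → v ∈ ball u t
  ∈-ball⁺ zero    duv≤0 = here (sym (d≡0⇒≡ (n≤0⇒n≡0 duv≤0)))
  ∈-ball⁺ {u} {v} (suc t) duv≤ with member? v (ball u t)
  ... | yes v∈ball = ∈-++⁺ˡ v∈ball
  -- Outside the smaller ball, `v` is at distance exactly `suc t`, so its predecessor on a geodesic
  -- is at distance `t`.
  ... | no v∉ball with last-step (≤-antisym duv≤ (≰⇒> (v∉ball ∘ ∈-ball⁺ t)))
  ... | w , duw , e = ∈-++⁺ʳ (ball u t)
    (∈-filter⁺ (new? (ball u t)) (complete v) (v∉ball , lose (∈-ball⁺ t (≤-reflexive duw)) e))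

  -- The vertices added last are all at distance exactly `suc t`, the earlier ones at distance at
  -- most `t`.
  ball-sorted : ∀ u t → AllPairs (λ x y → d u x ≤ d u y) (ball u t)
  ball-sorted u zero    = [] ∷ []
  ball-sorted u (suc t) = AllPairs.++⁺ (ball-sorted u t)
    (pairwise⇒AllPairs λ x∈ y∈ → ≤-trans (∈-ball⁻ (suc t) (∈-++⁺ʳ (ball u t) x∈)) (far y∈))
    (All.tabulate λ x∈ → All.tabulate λ y∈ → ≤-trans (∈-ball⁻ t x∈) (<⇒≤ (far y∈)))
    where
    far : ∀ {y} → y ∈ filter (new? (ball u t)) vs → t < d u y
    far y∈ = ≰⇒> (proj₁ (proj₂ (∈-filter⁻ (new? (ball u t)) {xs = vs} y∈)) ∘ ∈-ball⁺ t)

  order-complete : ∀ v → v ∈ order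
  order-complete v = ∈-ball⁺ (length vs) (≤-trans (<⇒≤ (d<n root v)) n≤length)

  module _ (r : ℕ) where

    private
      picksFrom : List (Fin n) → List (Fin n)
      picksFrom = foldr (insert r) []

    picksFrom-⊆ : ∀ xs {p} → p ∈ picksFrom xs → p ∈ xs
    picksFrom-⊆ (x ∷ xs) p∈ with close? r x (picksFrom xs)
    picksFrom-⊆ (x ∷ xs) p∈         | yes _ = there (picksFrom-⊆ xs p∈)
    picksFrom-⊆ (x ∷ xs) (here eq)  | no _  = here eq
    picksFrom-⊆ (x ∷ xs) (there p∈) | no _  = there (picksFrom-⊆ xs p∈)

    picksFrom-separated : ∀ xs → AllPairs (λ p q → r + r < d p q) (picksFrom xs)
    picksFrom-separated []       = []
    picksFrom-separated (x ∷ xs) with close? r x (picksFrom xs)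
    ... | yes _  = picksFrom-separated xs
    ... | no ¬cl = All.tabulate (λ {q} q∈ → ≰⇒> λ dxq≤ →
        ¬cl (lose q∈ (∈-ball⁺ (r + r) (subst (_≤ r + r) (d-sym x q) dxq≤))))
      ∷ picksFrom-separated xs

    -- A vertex is rejected only because of a pick made before it. That pick comes from the tail of
    -- the sorted list, hence is at least as far from the root. A vertex that is not rejected is its
    -- own pick.
    picksFrom-cover : ∀ xs → AllPairs (λ x y → d root x ≤ d root y) xs → ∀ {v} → v ∈ xs →
      ∃[ p ] (p ∈ picksFrom xs × d p v ≤ r + r × d root v ≤ d root p)
    picksFrom-cover (x ∷ xs) (x≤ ∷ sorted) v∈ with close? r x (picksFrom xs)
    picksFrom-cover (x ∷ xs) (x≤ ∷ sorted) (here refl) | yes cl with find cl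
    ... | p , p∈ , x∈ball = p , p∈ , ∈-ball⁻ (r + r) x∈ball , All.lookup x≤ (picksFrom-⊆ xs p∈)
    picksFrom-cover (x ∷ xs) (x≤ ∷ sorted) (here refl) | no _ =
      x , here refl , ≤-trans (≤-reflexive (d-refl x)) z≤n , ≤-refl
    picksFrom-cover (x ∷ xs) (x≤ ∷ sorted) (there v∈) | yes _ = picksFrom-cover xs sorted v∈
    picksFrom-cover (x ∷ xs) (x≤ ∷ sorted) (there v∈) | no _ with picksFrom-cover xs sorted v∈
    ... | p , p∈ , near , low = p , there p∈ , near , low

    picks-separated : AllPairs (λ p q → r + r < d p q) (picks r)
    picks-separated = picksFrom-separated order

    picks-cover : ∀ v → ∃[ p ] (p ∈ picks r × d p v ≤ r + r × d root v ≤ d root p)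
    picks-cover v = picksFrom-cover order (ball-sorted root (length vs)) (order-complete v)

    private
      candidates : Fin n → List (Fin n)
      candidates p = filter (λ x → member? x (ball p r)) order

      candidate : ∀ p {x} → d p x ≤ r → x ∈ candidates p
      candidate p {x} dpx≤r = ∈-filter⁺ (λ x → member? x (ball p r)) (order-complete x) (∈-ball⁺ r dpx≤r)

    centre-near : ∀ p → d p (centre r p) ≤ r
    centre-near p = ∈-ball⁻ r (proj₂ (∈-filter⁻ (λ x → member? x (ball p r)) {xs = order}
      (headOr-∈ root (candidate p {p} (≤-trans (≤-reflexive (d-refl p)) z≤n)))))

    centre-low : ∀ p {x} → d p x ≤ r → d root (centre r p) ≤ d root x
    centre-low p {x} dpx≤r = headOr-least {R = λ x y → d root x ≤ d root y} ≤-refl root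
      (AllPairs.filter⁺ (λ x → member? x (ball p r)) (ball-sorted root (length vs))) (candidate p dpx≤r)

    -- If the root is within `r` of `p`, then it is the centre, and `v` is no farther from it than
    -- `p`. Otherwise the geodesic from `p` to the root has a vertex at distance `r` from `p`; the
    -- centre is at most as far from the root, which supplies the last premise of the hyperbolicity
    -- assumption.
    centre-cover : ∀ δ →
      (∀ {s p c v} → d s v ≤ d s p → d p v ≤ r + r → d p c ≤ r → d s c + r ≤ d s p → d c v ≤ r + δ) →
      ∀ {p v} → d p v ≤ r + r → d root v ≤ d root p → d (centre r p) v ≤ r + δ
    centre-cover δ hyperbolic {p} {v} dpv≤ low with ≤-total (d p root) r
    ... | inj₁ dpr≤r = m≤n⇒m≤n+o δ
      (subst (λ x → d x v ≤ r) root≡centre (≤-trans low (subst (_≤ r) (d-sym p root) dpr≤r)))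
      where
      root≡centre : root ≡ centre r p
      root≡centre = d≡0⇒≡ (n≤0⇒n≡0 (≤-trans (centre-low p dpr≤r) (≤-reflexive (d-refl root))))
    ... | inj₂ r≤dpr with point-at p root r≤dpr
    ... | x , dpx , btw = hyperbolic low dpv≤ (centre-near p) (begin
      d root (centre r p) + r ≤⟨ +-monoˡ-≤ r (centre-low p (≤-reflexive dpx)) ⟩
      d root x + r            ≡⟨ +-comm (d root x) r ⟩
      r + d root x            ≡⟨ cong₂ _+_ (sym dpx) (d-sym root x) ⟩
      d p x + d x root        ≡⟨ btw ⟩
      d p root                ≡⟨ d-sym p root ⟩
      d root p                ∎)
      where open ≤-Reasoning

  module _ {j : ℕ} (j<length : j < length vs) (j-fits : length (picks j) ≤ suc j) where

    private
      fits? : ∀ r → Dec (length (picks r) ≤ suc r)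
      fits? r = length (picks r) ≤? suc r

      j∈ : j ∈ filter fits? (upTo (length vs))
      j∈ = ∈-filter⁺ fits? (∈-upTo⁺ j<length) j-fits

    radius-fits : length (picks radius) ≤ suc radius
    radius-fits = proj₂ (∈-filter⁻ fits? {xs = upTo (length vs)} (headOr-∈ 0 j∈))

    radius≤ : radius ≤ j
    radius≤ = headOr-least {R = _≤_} ≤-refl 0
      (AllPairs.filter⁺ fits? (AllPairs.applyUpTo⁺₁ (λ i → i) (length vs) (λ i<j _ → <⇒≤ i<j))) j∈

  module _ {r δ : ℕ} (r<length : r < length vs) {as : Vec (Fin n) (suc r)} (burns : Burns G as)
    (hyperbolic : ∀ {ρ s p c v} → d s v ≤ d s p → d p v ≤ ρ + ρ → d p c ≤ ρ → d s c + ρ ≤ d s p →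
      d c v ≤ ρ + δ)
    where

    private
      r-fits : length (picks r) ≤ suc r
      r-fits = packing burns _
        (AllPairs-lookup (λ {p} {q} → subst (r + r <_) (d-sym p q)) (picks-separated r))

    schedule-burns : Burns G (fromList (schedule δ))
    schedule-burns = cover-burns (map (centre radius) (picks radius)) (radius + δ) root λ v →
      let p , p∈ , near , low = picks-cover radius v in
      centre radius p , ∈-map⁺ (centre radius) p∈ , centre-cover radius δ hyperbolic near low

    schedule-short : length (schedule δ) ≤ suc r + suc r + δ
    schedule-short = begin
      length (schedule δ)
        ≡⟨ length-++ (map (centre radius) (picks radius)) ⟩
      length (map (centre radius) (picks radius)) + length (replicate (radius + δ) root)
        ≡⟨ cong₂ _+_ (length-map (centre radius) (picks radius)) (length-replicate (radius + δ)) ⟩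
      length (picks radius) + (radius + δ)
        -- The picks are counted by the test that selected `radius`; only then is `radius` compared
        -- with `r`. The second summand is rounded up by one to give twice `suc r`.
        ≤⟨ +-mono-≤ (≤-trans (radius-fits r<length r-fits) (s≤s radius≤r)) (+-monoˡ-≤ δ (m≤n⇒m≤1+n radius≤r)) ⟩
      suc r + (suc r + δ)
        ≡⟨ +-assoc (suc r) (suc r) δ ⟨
      suc r + suc r + δ ∎
      where
      open ≤-Reasoning
      radius≤r : radius ≤ r
      radius≤r = radius≤ r<length r-fits

-- Hyperbolicity of graphs of bounded tree-length

module _ {k : ℕ} (R : Fin k → Fin k → Set) (x : Fin k) where

  data SimplePath : Fin k → List (Fin k) → Set where
    done : SimplePath x [ x ]
    step : ∀ {a b vs} → R a b → SimplePath b vs → All (a ≢_) vs → SimplePath a (a ∷ vs)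

  -- The step of loop erasure: if `a` is already on the path, what precedes it is cut off; otherwise
  -- `a` can be put in front.
  suffix : ∀ a {b vs} → SimplePath b vs → ∃[ us ] SimplePath a us ⊎ All (a ≢_) vs
  suffix a {b} p with a Fin.≟ b
  suffix a p                | yes refl = inj₁ (_ , p)
  suffix a done             | no a≢x   = inj₂ (a≢x ∷ [])
  suffix a (step r p fresh) | no a≢b with suffix a p
  ... | inj₁ q    = inj₁ q
  ... | inj₂ a≢vs = inj₂ (a≢b ∷ a≢vs)

  loop-erase : ∀ {a} → Star R a x → ∃[ vs ] SimplePath a vs
  loop-erase ε = [ x ] , done
  loop-erase {a} (r ◅ w) with loop-erase w
  ... | vs , p with suffix a p
  ... | inj₁ q     = q
  ... | inj₂ fresh = a ∷ vs , step r p fresh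

  simplePath-unique : ∀ {a vs} → SimplePath a vs → Unique vs
  simplePath-unique done             = [] ∷ []
  simplePath-unique (step r p fresh) = fresh ∷ simplePath-unique p

  simplePath-linked : ∀ {S : Fin k → Fin k → Set} → (∀ {a b} → R a b → S a b) →
    ∀ {a vs z} → SimplePath a vs → S x z → Linked S (vs ++ [ z ])
  simplePath-linked R⊆S done                       s = s ∷ [-]
  simplePath-linked R⊆S (step r done _)            s = R⊆S r ∷ s ∷ [-]
  simplePath-linked R⊆S (step r p@(step _ _ _) _)  s = R⊆S r ∷ simplePath-linked R⊆S p s

-- Bridges and the Helly property in forests

module _ {k : ℕ} (F : Graph k) (acyclic : ∀ vs → ¬ IsCycle F vs) where

  Avoiding : Fin k → Fin k → Fin k → Fin k → Set
  Avoiding x y a b = Edge F a b × ¬ (a ≡ x × b ≡ y) × ¬ (a ≡ y × b ≡ x)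

  edge-irrefl : ∀ {x} → ¬ Edge F x x
  edge-irrefl {x} e rewrite adj-irrefl F x = e

  -- A detour from `y` to `x`, made simple, is closed to a cycle by the edge. Without a step it
  -- would make the edge a loop, and a single step would be the avoided edge itself; two or more
  -- steps give the three vertices that a cycle requires.
  edge-is-bridge : ∀ {x y} → Edge F x y → ¬ Star (Avoiding x y) y x
  edge-is-bridge {x} {y} e w with loop-erase (Avoiding x y) x w
  ... | _ , done                          = edge-irrefl e
  ... | _ , step (_ , _ , ¬yx) done _     = ¬yx (refl , refl)
  ... | _ , p@(step _ (step _ q _) _)     = acyclic _
    (simplePath-unique (Avoiding x y) x p ,
     s≤s (s≤s (nonempty (Avoiding x y) x q)) ,
     simplePath-linked (Avoiding x y) x proj₁ p e)
    where
    nonempty : ∀ R x {a vs} → SimplePath R x a vs → 1 ≤ length vs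
    nonempty R x done         = s≤s z≤n
    nonempty R x (step _ _ _) = s≤s z≤n

  Inside : (Fin k → Set) → Fin k → Fin k → Set
  Inside P = Star (λ a b → Edge F a b × P a × P b)

  -- The Helly property of three subtrees; the first is a walk from the second to the third, and
  -- the other two meet at b.  The last node of the walk in P also lies in Q, for otherwise the
  -- next edge of the walk could be bypassed through b.
  helly : ∀ {W P Q : Fin k → Set} → (∀ a → Dec (P a)) → (∀ a → Dec (Q a)) → ∀ {a b c} →
    W a → Inside W a c → P a → Q c →
    (∀ {i} → P i → Inside P b i) → (∀ {i} → Q i → Inside Q i b) →
    ∃[ i ] (W i × P i × Q i)
  helly {W} {P} {Q} P? Q? {a₀} {b} {c} Wa₀ w₀ Pa₀ Qc P-connected Q-connected with scan Wa₀ w₀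
    where
    scan : ∀ {a} → W a → Inside W a c →
      ∃[ i ] (W i × P i × Q i) ⊎ (¬ P a × Inside (¬_ ∘ P) a c)
    scan {a} Wa ε with P? a
    ... | yes Pa = inj₁ (a , Wa , Pa , Qc)
    ... | no ¬Pa = inj₂ (¬Pa , ε)
    scan {a} Wa (_◅_ {j = a′} (e , _ , Wa′) w) with scan Wa′ w
    ... | inj₁ found        = inj₁ found
    ... | inj₂ (¬Pa′ , w′) with P? a
    ... | no ¬Pa = inj₂ (¬Pa , (e , ¬Pa , ¬Pa′) ◅ w′)
    ... | yes Pa with Q? a
    ... | yes Qa = inj₁ (a , Wa , Pa , Qa)
    ... | no ¬Qa = contradiction bypass (edge-is-bridge e)
      where
      -- From `a′` along the rest of the walk to `c`, outside `P` and so missing `a`; from `c` to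
      -- `b` inside `Q`, again missing `a`; from `b` to `a` inside `P`, missing `a′`.
      bypass : Star (Avoiding a a′) a′ a
      bypass =
        Star.map (λ (e , ¬Pu , ¬Pv) → e , (λ { (refl , _) → ¬Pu Pa }) , (λ { (_ , refl) → ¬Pv Pa })) w′
        ◅◅ Star.map (λ (e , Qu , Qv) → e , (λ { (refl , _) → ¬Qa Qu }) , (λ { (_ , refl) → ¬Qa Qv }))
             (Q-connected Qc)
        ◅◅ Star.map (λ (e , Pu , Pv) → e , (λ { (_ , refl) → ¬Pa′ Pv }) , (λ { (refl , _) → ¬Pa′ Pu }))
             (P-connected Pa)
  ... | inj₁ found      = found
  ... | inj₂ (¬Pa₀ , _) = contradiction Pa₀ ¬Pa₀

-- The premise speaks only of a maximum already known to exist, and `P` is not assumed decidable. If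
-- some `l` above `L` satisfied `P`, then by induction on the distance to `N` nothing larger would
-- satisfy it, so `l` would be the maximum and hence at most `L`.
bounded-by-maximum : ∀ {P : ℕ → Set} {N L} → (∀ {l} → P l → l ≤ N) →
  (∀ m → IsMaximum P m → m ≤ L) → ∀ {l} → P l → l ≤ L
bounded-by-maximum {P} {N} {L} P≤N max≤L {l} Pl with l ≤? L
... | yes l≤L = l≤L
... | no l≰L  = contradiction Pl (impossible N (m≤m+n N l) (≰⇒> l≰L))
  where
  impossible : ∀ fuel {l} → N ≤ fuel + l → L < l → ¬ P l
  impossible fuel {l} N≤ L<l Pl = contradiction (max≤L l (Pl , above fuel N≤)) (<⇒≱ L<l)
    where
    above : ∀ fuel → N ≤ fuel + l → ∀ k → P k → k ≤ l
    above zero       N≤ k Pk = ≤-trans (P≤N Pk) N≤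
    above (suc fuel) N≤ k Pk = ≮⇒≥ λ l<k → impossible fuel
      (≤-trans N≤ (≤-trans (≤-reflexive (sym (+-suc fuel l))) (+-monoʳ-≤ fuel l<k)))
      (<-trans L<l l<k) Pk

module Hyperbolic {n k : ℕ} (G : Graph n) (walk : ∀ u v → Walk G u v) (D : TreeDecomposition G k)
  {L : ℕ} (length≤L : ∀ l → IsDecompositionLength D l → l ≤ L) where

  open Distance G walk

  bag-diameter : ∀ {i x y} → x ∈ˢ bag D i → y ∈ˢ bag D i → d x y ≤ L
  bag-diameter {i} {x} {y} x∈ y∈ = bounded-by-maximum
    (λ { (_ , x , y , _ , _ , dist) → subst (_≤ n) (d-unique dist) (<⇒≤ (d<n x y)) })
    length≤L (i , x , y , x∈ , y∈ , d-isDistance x y)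

  via-bag : ∀ {i x y z} → x ∈ˢ bag D i → y ∈ˢ bag D i → d x z ≤ L + d y z
  via-bag {x = x} {y} {z} x∈ y∈ = ≤-trans (d-triangle x y z) (+-monoˡ-≤ (d y z) (bag-diameter x∈ y∈))

  detour : ∀ c v {i x y} → x ∈ˢ bag D i → y ∈ˢ bag D i → d c v ≤ d c x + L + d y v
  detour c v {x = x} {y} x∈ y∈ = ≤-trans (d-triangle c x v)
    (≤-trans (+-monoʳ-≤ (d c x) (via-bag x∈ y∈)) (≤-reflexive (sym (+-assoc (d c x) L (d y v)))))

  Meets : (Fin n → Set) → Fin k → Set
  Meets A i = ∃[ z ] (z ∈ˢ bag D i × A z)

  meets? : ∀ {A} → (∀ z → Dec (A z)) → ∀ i → Dec (Meets A i)
  meets? A? i = Fin.any? λ z → (z ∈ˢ? bag D i) ×-dec A? z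

  private
    InsideTree : (Fin k → Set) → Fin k → Fin k → Set
    InsideTree = Inside (tree D) (proj₂ (tree-isTree D))

  inside-bags : ∀ {A : Fin n → Set} {z i j} → A z → z ∈ˢ bag D i → z ∈ˢ bag D j → InsideTree (Meets A) i j
  inside-bags {z = z} Az z∈i z∈j = Star.map
    (λ (e , z∈a , z∈b) → e , (z , z∈a , Az) , (z , z∈b , Az)) (bags-connected D z _ _ z∈i z∈j)

  -- A geodesic from `z` to `y` stays in the interval, its consecutive vertices share a bag, and the
  -- bags of each vertex are connected. So the bags meeting an interval form a subtree, without a
  -- choice of geodesic between its ends.
  inside-interval : ∀ {x y z i j} → Between x y z → z ∈ˢ bag D i → y ∈ˢ bag D j →
    InsideTree (Meets (Between x y)) i j
  inside-interval {x} {y} {z₀} {j = j} btw z∈ y∈ = go (d z₀ y) refl btw z∈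
    where
    go : ∀ m {z i} → d z y ≡ m → Between x y z → z ∈ˢ bag D i → InsideTree (Meets (Between x y)) i j
    go zero    dzy btw z∈ with refl ← d≡0⇒≡ dzy = inside-bags btw z∈ y∈
    go (suc m) {z} dzy btw z∈ with first-step dzy
    ... | w , e , dwy with covers-edge D _ _ e
    ... | _ , z∈′ , w∈ = inside-bags btw z∈ z∈′ ◅◅ go m dwy (≤-antisym shortcut (d-triangle x w y)) w∈
      where
      open ≤-Reasoning
      shortcut : d x w + d w y ≤ d x y
      shortcut = begin
        d x w + d w y     ≤⟨ +-mono-≤ (≤-trans (d-triangle x z w) (+-monoʳ-≤ (d x z) (d-edge e))) (≤-reflexive dwy) ⟩
        d x z + 1 + m     ≡⟨ +-assoc (d x z) 1 m ⟩
        d x z + suc m     ≡⟨ cong (d x z +_) dzy ⟨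
        d x z + d z y     ≡⟨ btw ⟩
        d x y             ∎

  reverse-inside : ∀ {P i j} → InsideTree P i j → InsideTree P j i
  reverse-inside = Star.reverse λ (e , Pa , Pb) → edge-sym (tree D) e , Pb , Pa

  between-left : ∀ x y → Between x y x
  between-left x y = cong (_+ d x y) (d-refl x)

  -- The Helly property for the sides of a triangle on `s`, `p` and `v`, with the side from `p` to
  -- `s` routed through `c`. The sides meet pairwise in bags of the corners.
  common-bag : ∀ s p c v → ∃[ i ] (Meets (λ x → Between p c x ⊎ Between c s x) i ×
    Meets (Between p v) i × Meets (Between s v) i)
  common-bag s p c v with covers-vertex D s | covers-vertex D p | covers-vertex D c | covers-vertex D v
  ... | _ , s∈ | _ , p∈ | _ , c∈ | _ , v∈ = helly (tree D) (proj₂ (tree-isTree D))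
    (meets? (between? p v)) (meets? (between? s v))
    (p , p∈ , inj₁ (between-left p c))
    (widen inj₁ (inside-interval (between-left p c) p∈ c∈) ◅◅
     widen inj₂ (inside-interval (between-left c s) c∈ s∈))
    (p , p∈ , between-left p v) (s , s∈ , between-left s v)
    (λ (_ , z∈ , btw) → reverse-inside (inside-interval btw z∈ v∈))
    (λ (_ , z∈ , btw) → inside-interval btw z∈ v∈)
    where
    widen : ∀ {A B : Fin n → Set} → (∀ {z} → A z → B z) → ∀ {i j} → InsideTree (Meets A) i j → InsideTree (Meets B) i j
    widen A⊆B = Star.map λ { (e , (y , y∈ , Ay) , (z , z∈ , Az)) → e , (y , y∈ , A⊆B Ay) , (z , z∈ , A⊆B Az) }

  hyperbolic : ∀ {r s p c v} → d s v ≤ d s p → d p v ≤ r + r → d p c ≤ r → d s c + r ≤ d s p →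
    d c v ≤ r + (L + L)
  hyperbolic {r} {s} {p} {c} {v} dsv≤dsp dpv≤2r dpc≤r dsc+r≤dsp with common-bag s p c v
  -- The branching bag lies beyond `c` as seen from `p`: up to `L + L`, a geodesic from `p` to `v`
  -- has spent `r` before it can count towards `d c v`, and its length is at most `r + r`.
  ... | _ , (x , x∈ , inj₂ btw-x) , (q , q∈ , btw-q) , _ = +-cancelˡ-≤ r _ _ (begin
    r + d c v                           ≤⟨ +-monoʳ-≤ r (detour c v x∈ q∈) ⟩
    r + (d c x + L + d q v)             ≡⟨ swap₁ r (d c x) L (d q v) ⟩
    d c x + r + (L + d q v)             ≤⟨ +-monoˡ-≤ _ (≤-trans past-x (via-bag x∈ q∈)) ⟩
    L + d q p + (L + d q v)             ≡⟨ swap₂ L (d q p) (d q v) ⟩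
    d q p + d q v + (L + L)             ≡⟨ cong (λ y → y + d q v + (L + L)) (d-sym q p) ⟩
    d p q + d q v + (L + L)             ≡⟨ cong (_+ (L + L)) btw-q ⟩
    d p v + (L + L)                     ≤⟨ +-monoˡ-≤ (L + L) dpv≤2r ⟩
    r + r + (L + L)                     ≡⟨ +-assoc r r (L + L) ⟩
    r + (r + (L + L))                   ∎)
    where
    open ≤-Reasoning
    swap₁ : ∀ r a l b → r + (a + l + b) ≡ a + r + (l + b)
    swap₁ = solve-∀
    swap₂ : ∀ l a b → l + a + (l + b) ≡ a + b + (l + l)
    swap₂ = solve-∀
    past-x : d c x + r ≤ d x p
    past-x = +-cancelʳ-≤ (d x s) _ _ (begin
      d c x + r + d x s    ≡⟨ +-assoc (d c x) r _ ⟩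
      d c x + (r + d x s)  ≡⟨ cong (d c x +_) (+-comm r (d x s)) ⟩
      d c x + (d x s + r)  ≡⟨ +-assoc (d c x) _ r ⟨
      d c x + d x s + r    ≡⟨ cong (_+ r) (trans btw-x (d-sym c s)) ⟩
      d s c + r            ≤⟨ dsc+r≤dsp ⟩
      d s p                ≤⟨ d-triangle s x p ⟩
      d s x + d x p        ≡⟨ cong (_+ d x p) (d-sym s x) ⟩
      d x s + d x p        ≡⟨ +-comm (d x s) _ ⟩
      d x p + d x s        ∎)
  -- The branching bag lies between `p` and `c`. As `v` is no farther from `s` than `p`, the way
  -- from the bag to `v` exceeds the way to `p` by at most `L`; it is therefore replaced by the
  -- latter, at a further cost of `L` for crossing the bag.
  ... | _ , (x , x∈ , inj₁ btw-x) , _ , (w , w∈ , btw-w) = begin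
    d c v                               ≤⟨ detour c v x∈ w∈ ⟩
    d c x + L + d w v                   ≤⟨ +-monoʳ-≤ (d c x + L) before-w ⟩
    d c x + L + (L + d x p)             ≡⟨ swap₃ (d c x) L (d x p) ⟩
    d x p + d c x + (L + L)             ≡⟨ cong (_+ (L + L)) (cong₂ _+_ (d-sym x p) (d-sym c x)) ⟩
    d p x + d x c + (L + L)             ≡⟨ cong (_+ (L + L)) btw-x ⟩
    d p c + (L + L)                     ≤⟨ +-monoˡ-≤ (L + L) dpc≤r ⟩
    r + (L + L)                         ∎
    where
    open ≤-Reasoning
    swap₃ : ∀ a l b → a + l + (l + b) ≡ b + a + (l + l)
    swap₃ = solve-∀
    before-w : d w v ≤ L + d x p
    before-w = +-cancelˡ-≤ (d s w) _ _ (begin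
      d s w + d w v         ≡⟨ btw-w ⟩
      d s v                 ≤⟨ dsv≤dsp ⟩
      d s p                 ≤⟨ d-triangle s w p ⟩
      d s w + d w p         ≤⟨ +-monoʳ-≤ (d s w) (via-bag w∈ x∈) ⟩
      d s w + (L + d x p)   ∎)

-- From numerals to vertices

module _ {V W : Set} (φ : V → W) where

  filter-map : ∀ {P : W → Set} {Q : V → Set} (P? : ∀ w → Dec (P w)) (Q? : ∀ v → Dec (Q v)) →
    (∀ v → P (φ v) ⇔ Q v) → ∀ xs → filter P? (map φ xs) ≡ map φ (filter Q? xs)
  filter-map P? Q? P⇔Q []       = refl
  filter-map P? Q? P⇔Q (x ∷ xs) rewrite does-⇔ (P⇔Q x) (P? (φ x)) (Q? x) with does (Q? x)
  ... | true  = cong (φ x ∷_) (filter-map P? Q? P⇔Q xs)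
  ... | false = filter-map P? Q? P⇔Q xs

  any-map-⇔ : ∀ {P : W → Set} {Q : V → Set} → (∀ v → P (φ v) ⇔ Q v) → ∀ {xs} → Any P (map φ xs) ⇔ Any Q xs
  any-map-⇔ P⇔Q = mk⇔ (Any.map (Equivalence.to (P⇔Q _)) ∘ Any.map⁻) (Any.map⁺ ∘ Any.map (Equivalence.from (P⇔Q _)))

  headOr-map : ∀ z xs → headOr (φ z) (map φ xs) ≡ φ (headOr z xs)
  headOr-map z []      = refl
  headOr-map z (_ ∷ _) = refl

module Simulation {V W : Set} {E : V → V → Set} {F : W → W → Set}
  (_≟ⱽ_ : DecidableEquality V) (_≟ᵂ_ : DecidableEquality W)
  (E? : ∀ u v → Dec (E u v)) (F? : ∀ u v → Dec (F u v))
  (φ : V → W) (φ-injective : Injective _≡_ _≡_ φ) (F⇔E : ∀ u v → F (φ u) (φ v) ⇔ E u v)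
  (vs : List V) (root : V) where

  private
    module A = Algorithm _≟ⱽ_ E? vs root
    module B = Algorithm _≟ᵂ_ F? (map φ vs) (φ root)

  member-⇔ : ∀ v {S} → Any (φ v ≡_) (map φ S) ⇔ Any (v ≡_) S
  member-⇔ v = any-map-⇔ φ λ w → mk⇔ φ-injective (cong φ)

  new-⇔ : ∀ S v → B.New (map φ S) (φ v) ⇔ A.New S v
  new-⇔ S v = mk⇔
    (Product.map (_∘ from (member-⇔ v)) (to edges))
    (Product.map (_∘ to (member-⇔ v)) (from edges))
    where
    open Equivalence
    edges : Any (λ w → F w (φ v)) (map φ S) ⇔ Any (λ w → E w v) S
    edges = any-map-⇔ φ λ w → F⇔E w v

  expand-map : ∀ S → B.expand (map φ S) ≡ map φ (A.expand S)
  expand-map S = trans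
    (cong (map φ S ++_) (filter-map φ (B.new? (map φ S)) (A.new? S) (new-⇔ S) vs))
    (sym (map-++ φ S _))

  ball-map : ∀ u t → B.ball (φ u) t ≡ map φ (A.ball u t)
  ball-map u zero    = refl
  ball-map u (suc t) = trans (cong B.expand (ball-map u t)) (expand-map (A.ball u t))

  order-map : B.order ≡ map φ A.order
  order-map = trans (cong (B.ball (φ root)) (length-map φ vs)) (ball-map root (length vs))

  member-ball-⇔ : ∀ u t v → Any (φ v ≡_) (B.ball (φ u) t) ⇔ Any (v ≡_) (A.ball u t)
  member-ball-⇔ u t v = subst (λ S → Any (φ v ≡_) S ⇔ Any (v ≡_) (A.ball u t)) (sym (ball-map u t)) (member-⇔ v)

  insert-map : ∀ r v ps → B.insert r (φ v) (map φ ps) ≡ map φ (A.insert r v ps)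
  insert-map r v ps
    rewrite does-⇔ (any-map-⇔ φ (λ p → member-ball-⇔ p (r + r) v)) (B.close? r (φ v) (map φ ps)) (A.close? r v ps)
    with does (A.close? r v ps)
  ... | true  = refl
  ... | false = refl

  picks-map : ∀ r → B.picks r ≡ map φ (A.picks r)
  picks-map r = trans (cong (foldr (B.insert r) []) order-map) (go A.order)
    where
    go : ∀ xs → foldr (B.insert r) [] (map φ xs) ≡ map φ (foldr (A.insert r) [] xs)
    go []       = refl
    go (x ∷ xs) = trans (cong (B.insert r (φ x)) (go xs)) (insert-map r x (foldr (A.insert r) [] xs))

  centre-map : ∀ r p → B.centre r (φ p) ≡ φ (A.centre r p)
  centre-map r p = trans
    (cong (headOr (φ root)) (trans
      (cong (filter (λ x → B.member? x (B.ball (φ p) r))) order-map)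
      (filter-map φ (λ x → B.member? x (B.ball (φ p) r)) (λ x → A.member? x (A.ball p r)) (member-ball-⇔ p r) A.order)))
    (headOr-map φ root (filter (λ x → A.member? x (A.ball p r)) A.order))

  radius-map : B.radius ≡ A.radius
  radius-map = trans
    (cong (λ k → headOr 0 (filter (λ r → length (B.picks r) ≤? suc r) (upTo k))) (length-map φ vs))
    (cong (headOr 0) (filter-≐ (λ r → length (B.picks r) ≤? suc r) (λ r → length (A.picks r) ≤? suc r)
      ((λ {r} → subst (_≤ suc r) (same-length r)) , (λ {r} → subst (_≤ suc r) (sym (same-length r))))
      (upTo (length vs))))
    where
    same-length : ∀ r → length (B.picks r) ≡ length (A.picks r)
    same-length r = trans (cong length (picks-map r)) (length-map φ (A.picks r))

  -- The algorithm inspects vertices only through equality and adjacency, both of which `φ`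
  -- preserves and reflects; every branch is thus decided alike in the two runs.
  schedule-map : ∀ {ws z} → ws ≡ map φ vs → z ≡ φ root → ∀ k →
    Algorithm.schedule _≟ᵂ_ F? ws z k ≡ map φ (A.schedule k)
  schedule-map refl refl k = begin
    map (B.centre B.radius) (B.picks B.radius) ++ replicate (B.radius + k) (φ root)
      ≡⟨ cong (λ r → map (B.centre r) (B.picks r) ++ replicate (r + k) (φ root)) radius-map ⟩
    map (B.centre r) (B.picks r) ++ replicate (r + k) (φ root)
      ≡⟨ cong (λ ps → map (B.centre r) ps ++ replicate (r + k) (φ root)) (picks-map r) ⟩
    map (B.centre r) (map φ (A.picks r)) ++ replicate (r + k) (φ root)
      ≡⟨ cong₂ _++_ centres (sym (map-replicate φ (r + k) root)) ⟩
    map φ (map (A.centre r) (A.picks r)) ++ map φ (replicate (r + k) root)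
      ≡⟨ map-++ φ (map (A.centre r) (A.picks r)) _ ⟨
    map φ (A.schedule k) ∎
    where
    open ≡-Reasoning
    r : ℕ
    r = A.radius
    centres : map (B.centre r) (map φ (A.picks r)) ≡ map φ (map (A.centre r) (A.picks r))
    centres = trans (sym (map-∘ (A.picks r))) (trans (map-cong (centre-map r) (A.picks r)) (map-∘ (A.picks r)))

entry-suc : ∀ {A : Set} (z x : A) xs i → entry z (x ∷ xs) (suc i) ≡ entry z xs i
entry-suc z x xs i = cong (headOr z) (drops i)
  where
  drops : ∀ i → tailOr[] (foldr (λ _ → tailOr[]) (x ∷ xs) (replicate i 0)) ≡ foldr (λ _ → tailOr[]) xs (replicate i 0)
  drops zero    = refl
  drops (suc i) = cong tailOr[] (drops i)

entry-tabulate : ∀ {A : Set} (z : A) {n} (f : Fin n → A) i → entry z (tabulate f) (toℕ i) ≡ f i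
entry-tabulate z f zero    = refl
entry-tabulate z f (suc i) = trans (entry-suc z (f zero) _ (toℕ i)) (entry-tabulate z (f ∘ suc) i)

entry-matrix : ∀ {m n} (M : Fin m → Fin n → Bool) i j →
  entry 0 (entry [] (matrix M) (toℕ i)) (toℕ j) ≡ (if M i j then 1 else 0)
entry-matrix M i j = trans
  (cong (λ row → entry 0 row (toℕ j)) (entry-tabulate [] (λ i → tabulate λ j → if M i j then 1 else 0) i))
  (entry-tabulate 0 (λ j → if M i j then 1 else 0) j)

edge-⇔ : ∀ {n} (G : Graph n) u v → (¬ entry 0 (entry [] (matrix (adj G)) (toℕ u)) (toℕ v) ≡ 0) ⇔ Edge G u v
edge-⇔ G u v rewrite entry-matrix (adj G) u v with adj G u v
... | true  = mk⇔ _ (λ _ ())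
... | false = mk⇔ (λ 0≢0 → contradiction refl 0≢0) λ ()

tabulate-toℕ : ∀ {A : Set} (f : ℕ → A) n → tabulate {n = n} (f ∘ toℕ) ≡ applyUpTo f n
tabulate-toℕ f zero    = refl
tabulate-toℕ f (suc n) = cong (f 0 ∷_) (tabulate-toℕ (f ∘ suc) n)

vertices-matrix : ∀ {m n} (M : Fin m → Fin n → Bool) → upTo (length (matrix M)) ≡ map toℕ (allFin m)
vertices-matrix {m} M = trans
  (cong upTo (length-tabulate (λ i → tabulate λ j → if M i j then 1 else 0)))
  (trans (sym (tabulate-toℕ (λ i → i) m)) (sym (map-tabulate (λ i → i) toℕ)))

inputSchedule : ℕ → ⟦ Input ⟧ → ⟦ Schedule ⟧
inputSchedule δ (M , _) = Algorithm.schedule _≟_ (edge? M) (upTo (length M)) 0 δ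

inputSchedule≡ : ∀ {n} (G : Graph (suc n)) δ x →
  (∀ u v → (¬ entry 0 (entry [] (proj₁ x) (toℕ u)) (toℕ v) ≡ 0) ⇔ Edge G u v) →
  upTo (length (proj₁ x)) ≡ map toℕ (allFin (suc n)) →
  inputSchedule δ x ≡ map toℕ (Algorithm.schedule Fin._≟_ (λ u v → T? (adj G u v)) (allFin (suc n)) zero δ)
inputSchedule≡ {n} G δ (M , _) edges vertices =
  Simulation.schedule-map Fin._≟_ _≟_ (λ u v → T? (adj G u v)) (edge? M)
    toℕ Fin.toℕ-injective edges (allFin (suc n)) zero vertices refl δ

-- The approximation factor

n≤2^n : ∀ n → n ≤ 2 ^ n
n≤2^n zero    = z≤n
n≤2^n (suc n) = +-mono-≤ (m^n>0 2 n) (≤-trans (n≤2^n n) (m≤m+n (2 ^ n) 0))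

-- From `b ≤ 2 ^ b`, the product is at most `2 ^ (2 b + 1)`, which bounds the left side by
-- `2 b + 2`. As `b` is positive, this is at most `4 * b`.
log-bound : ∀ {d b} → d < b * (b + b) → suc ⌊log₂ d ⌋ ≤ 4 * b
log-bound {d} {suc r} d< = begin
  suc ⌊log₂ d ⌋                     ≤⟨ s≤s (⌊log₂⌋-mono-≤ (<⇒≤ d<)) ⟩
  suc ⌊log₂ b * (b + b) ⌋           ≤⟨ s≤s (⌊log₂⌋-mono-≤ (*-mono-≤ (n≤2^n b) (+-mono-≤ (n≤2^n b) (n≤2^n b)))) ⟩
  suc ⌊log₂ 2 ^ b * (2 ^ b + 2 ^ b) ⌋ ≡⟨ cong (suc ∘ ⌊log₂_⌋) (double (2 ^ b)) ⟩
  suc ⌊log₂ 2 * (2 ^ b * 2 ^ b) ⌋   ≡⟨ cong (λ k → suc ⌊log₂ 2 * k ⌋) (^-distribˡ-+-* 2 b b) ⟨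
  suc ⌊log₂ 2 ^ suc (b + b) ⌋       ≡⟨ cong suc (⌊log₂[2^n]⌋≡n (suc (b + b))) ⟩
  suc (suc (b + b))                 ≤⟨ ≤-trans (m≤m+n _ (r + r)) (≤-reflexive (quadruple r)) ⟩
  4 * b                             ∎
  where
  open ≤-Reasoning
  b : ℕ
  b = suc r
  double : ∀ k → k * (k + k) ≡ 2 * (k * k)
  double = solve-∀
  quadruple : ∀ r → suc (suc (suc r + suc r)) + (r + r) ≡ 4 * suc r
  quadruple = solve-∀

-- Any unbounded lower bound for b in terms of d would do; the logarithm is cruder than √(d / 2).
errorᵘ : ℕ → ℕ → ℚᵘ
errorᵘ δ d = mkℚᵘ (ℤ.+ (4 * δ)) ⌊log₂ d ⌋

-- `mkℚᵘ` stores the denominator minus one, so the value is `4 δ / (1 + ⌊log₂ d⌋)`. Estimates are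
-- made on the unnormalised fraction and carried over.
error : ℕ → ℕ → ℚ
error δ d = fromℚᵘ (errorᵘ δ d)

error-nonneg : ∀ δ d → 0ℚ ℚ.≤ error δ d
error-nonneg δ d = ℚ.toℚᵘ-cancel-≤ (ℚᵘ.≤-respʳ-≃ (ℚᵘ.≃-sym (ℚ.toℚᵘ-fromℚᵘ (errorᵘ δ d)))
  (ℚᵘ.nonNegative⁻¹ (errorᵘ δ d)))

error-tendsToZero : ∀ δ → TendsToZero (error δ)
error-tendsToZero δ (mkℚ (ℤ.+ zero)    q _)   (ℚ.*<* (ℤ.+<+ ()))
error-tendsToZero δ (mkℚ ℤ.-[1+ p ] q _)   (ℚ.*<* ())
-- The threshold makes the logarithm at least `4 * δ * suc q`, so the error is already below
-- `1 / suc q`, whatever the numerator of `η`.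
error-tendsToZero δ η@(mkℚ (ℤ.+ suc p) q _) 0<η = 2 ^ (4 * δ * suc q) , λ d N≤d →
  subst (ℚ._< η) (sym (ℚ.0≤p⇒∣p∣≡p (error-nonneg δ d)))
    (ℚ.toℚᵘ-cancel-< (ℚᵘ.<-respˡ-≃ (ℚᵘ.≃-sym (ℚ.toℚᵘ-fromℚᵘ (errorᵘ δ d))) (ℚᵘ.*<* (below d N≤d))))
  where
  open ≤-Reasoning
  below : ∀ d → 2 ^ (4 * δ * suc q) ≤ d → ℤ.+ (4 * δ) ℤ.* ℤ.+ suc q ℤ.< ℤ.+ suc p ℤ.* ℤ.+ suc ⌊log₂ d ⌋
  below d N≤d = subst₂ ℤ._<_ (ℤ.pos-* (4 * δ) (suc q)) (ℤ.pos-* (suc p) (suc ⌊log₂ d ⌋)) (ℤ.+<+ (begin-strict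
    4 * δ * suc q                 ≡⟨ ⌊log₂[2^n]⌋≡n (4 * δ * suc q) ⟨
    ⌊log₂ 2 ^ (4 * δ * suc q) ⌋   ≤⟨ ⌊log₂⌋-mono-≤ N≤d ⟩
    ⌊log₂ d ⌋                     <⟨ n<1+n _ ⟩
    suc ⌊log₂ d ⌋                 ≤⟨ m≤n*m (suc ⌊log₂ d ⌋) (suc p) ⟩
    suc p * suc ⌊log₂ d ⌋         ∎))

ratio-bound : ∀ {m b δ d} → m ≤ b + b + δ → d < b * (b + b) →
  fromℕ m ℚ.≤ (fromℕ 2 ℚ.+ error δ d) ℚ.* fromℕ b
ratio-bound {m} {b} {δ} {d} m≤ d< = ℚ.toℚᵘ-cancel-≤ (begin
  toℚᵘ (fromℕ m)
    ≃⟨ ℚ.toℚᵘ-fromℚᵘ (mkℚᵘ (ℤ.+ m) 0) ⟩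
  mkℚᵘ (ℤ.+ m) 0
    ≤⟨ ℚᵘ.*≤* cross ⟩
  (mkℚᵘ (ℤ.+ 2) 0 ℚᵘ.+ errorᵘ δ d) ℚᵘ.* mkℚᵘ (ℤ.+ b) 0
    ≃⟨ ℚᵘ.*-cong
         (ℚᵘ.+-cong (ℚ.toℚᵘ-fromℚᵘ (mkℚᵘ (ℤ.+ 2) 0)) (ℚ.toℚᵘ-fromℚᵘ (errorᵘ δ d)))
         (ℚ.toℚᵘ-fromℚᵘ (mkℚᵘ (ℤ.+ b) 0)) ⟨
  (toℚᵘ (fromℕ 2) ℚᵘ.+ toℚᵘ (error δ d)) ℚᵘ.* toℚᵘ (fromℕ b)
    ≃⟨ ℚᵘ.*-congʳ {toℚᵘ (fromℕ b)} (ℚ.toℚᵘ-homo-+ (fromℕ 2) (error δ d)) ⟨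
  toℚᵘ (fromℕ 2 ℚ.+ error δ d) ℚᵘ.* toℚᵘ (fromℕ b)
    ≃⟨ ℚ.toℚᵘ-homo-* (fromℕ 2 ℚ.+ error δ d) (fromℕ b) ⟨
  toℚᵘ ((fromℕ 2 ℚ.+ error δ d) ℚ.* fromℕ b) ∎)
  where
  open ℚᵘ.≤-Reasoning
  l : ℕ
  l = suc ⌊log₂ d ⌋

  -- The claim multiplied by the denominator `l`. The additive `δ` is absorbed because `l ≤ 4 * b`;
  -- this is the origin of the 4 in `errorᵘ`.
  natural : m * l ≤ (2 * l + 4 * δ) * b
  natural = ≤-trans (*-monoˡ-≤ l m≤) (≤-trans (≤-reflexive (expand b δ l))
    (≤-trans (+-monoʳ-≤ (2 * l * b) (*-monoʳ-≤ δ (log-bound {d} {b} d<))) (≤-reflexive (collect b δ l))))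
    where
    expand : ∀ b δ l → (b + b + δ) * l ≡ 2 * l * b + δ * l
    expand = solve-∀
    collect : ∀ b δ l → 2 * l * b + δ * (4 * b) ≡ (2 * l + 4 * δ) * b
    collect = solve-∀

  cross : ℚᵘ.↥ mkℚᵘ (ℤ.+ m) 0 ℤ.* ℚᵘ.↧ ((mkℚᵘ (ℤ.+ 2) 0 ℚᵘ.+ errorᵘ δ d) ℚᵘ.* mkℚᵘ (ℤ.+ b) 0) ℤ.≤
    ℚᵘ.↥ ((mkℚᵘ (ℤ.+ 2) 0 ℚᵘ.+ errorᵘ δ d) ℚᵘ.* mkℚᵘ (ℤ.+ b) 0) ℤ.* ℚᵘ.↧ mkℚᵘ (ℤ.+ m) 0
  cross = subst₂ ℤ._≤_
    (trans (ℤ.pos-* m l) (cong (λ k → ℤ.+ m ℤ.* ℤ.+ k) (sym (trans (*-identityʳ (1 * l)) (*-identityˡ l)))))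
    (trans (ℤ.pos-* (2 * l + 4 * δ) b) (trans
      (cong (ℤ._* ℤ.+ b) (cong₂ ℤ._+_ (ℤ.pos-* 2 l) (sym (ℤ.*-identityʳ (ℤ.+ (4 * δ))))))
      (sym (ℤ.*-identityʳ _))))
    (ℤ.+≤+ natural)

-- The guarantee for encoded inputs

encodeSchedule-fromList : ∀ {n} (S : List (Fin n)) → encodeSchedule (fromList S) ≡ map toℕ S
encodeSchedule-fromList S = trans (toList-map toℕ (fromList S)) (cong (map toℕ) (toList∘fromList S))

abstract
  algorithmᶜ : ∀ δ → PolyTime Input Schedule (inputSchedule δ)
  algorithmᶜ δ = fstᶜ ▸ scheduleᶜ δ

module _ {n k : ℕ} (G : Graph (suc n)) (walk : ∀ u v → Walk G u v) (D : TreeDecomposition G k)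
  {L : ℕ} (length≤L : ∀ l → IsDecompositionLength D l → l ≤ L) where

  approximation : ∀ {r} → IsBurningNumber G (suc r) →
    ∃[ S ] (inputSchedule (L + L) (encode G D) ≡ map toℕ S ×
      Burns G (fromList S) × length S ≤ suc r + suc r + (L + L))
  approximation burningNumber@((as , burns) , _) =
    Algorithm.schedule Fin._≟_ (λ u v → T? (adj G u v)) (allFin (suc n)) zero (L + L) ,
    inputSchedule≡ G (L + L) (encode G D) (edge-⇔ G) (vertices-matrix (adj G)) ,
    Correctness.schedule-burns G walk (allFin (suc n)) ∈-allFin n≤length zero r<length burns hyperbolic ,
    Correctness.schedule-short G walk (allFin (suc n)) ∈-allFin n≤length zero r<length burns hyperbolic
    where
    open Hyperbolic G walk D length≤L

    n≤length : suc n ≤ length (allFin (suc n))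
    n≤length = ≤-reflexive (sym (length-tabulate {n = suc n} (λ i → i)))

    r<length : _ < length (allFin (suc n))
    r<length = ≤-trans (Burning.burningNumber≤ G walk burningNumber) n≤length

theorem4 : ∀ (L : ℕ) →
    Σ[ algorithm ∈ Input ⇒ Schedule ]
    Σ[ c ∈ ℕ ] Σ[ e ∈ ℕ ]
    Σ[ ε ∈ (ℕ → ℚ) ]
    (∀ d → 0ℚ ℚ.≤ ε d) ×
    TendsToZero ε ×
    (∀ (n k : ℕ) (G : Graph n) (D : TreeDecomposition G k) (d b : ℕ) →
    Connected G →
    IsDiameter G d →
    (∀ l → IsDecompositionLength D l → l ≤ L) →
    IsBurningNumber G b →
    Σ[ m ∈ ℕ ] Σ[ as ∈ Vec (Fin n) m ] Σ[ t ∈ ℕ ]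
    algorithm ∣ encode G D ⇓ encodeSchedule as ∙ t ×
    t ≤ polyBound c e (size Input (encode G D)) ×
    Burns G as ×
    fromℕ m ℚ.≤ (fromℕ 2 ℚ.+ ε d) ℚ.* fromℕ b)
theorem4 L =
  program algorithm , c , e , error (L + L) , error-nonneg (L + L) , error-tendsToZero (L + L) , λ where
    zero    k G D d b (() , _)
    (suc n) k G D d zero    (v , _) _ _ ((as , burns) , _) → nothing-burned G (burns v)
    (suc n) k G D d (suc r) (_ , walk) ((u , v , duv) , _) length≤L burningNumber@((as , burns) , _) →
      let S , S≡ , S-burns , S-short = approximation G walk D length≤L burningNumber
          t , halts-in-t , t≤ = halts algorithm (encode G D)
      in
      length S , fromList S , t ,
      subst (λ out → program algorithm ∣ encode G D ⇓ out ∙ t)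
        (trans S≡ (sym (encodeSchedule-fromList S))) halts-in-t ,
      ≤-trans t≤ (cost≤ (size Input (encode G D))) ,
      S-burns ,
      ratio-bound {length S} {suc r} {L + L} {d} S-short (subst (_< suc r * (suc r + suc r))
        (Distance.d-unique G walk duv) (Burning.diameter< G walk burns u v))
  where
  algorithm : PolyTime Input Schedule _
  algorithm = algorithmᶜ (L + L)

  c e : ℕ
  c = proj₁ (eval≤polyBound (cost algorithm))
  e = proj₁ (proj₂ (eval≤polyBound (cost algorithm)))

  cost≤ : ∀ s → eval (cost algorithm) s ≤ polyBound c e s
  cost≤ = proj₂ (proj₂ (eval≤polyBound (cost algorithm)))

  nothing-burned : ∀ {n} (G : Graph n) {as : Vec (Fin n) 0} {v} {A : Set} → Burned G as 0 v → A
  nothing-burned G ()
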